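{- For every prime $p$ and every integer $k \geq 1$ there is an integer $N$ such that, if $M$ is a simple $\mathrm{GF}(p)$-representable matroid with rank at least $N$, then for any $2$-colouring of the points of $M$ there is a monochromatic rank-$k$ flat of $M$.
   Context: Matroids are finite. $\mathrm{GF}(p)$ is the field with $p$ elements. A point of a matroid is a rank-$1$ flat; in a simple matroid the points correspond to the elements of the ground set. A flat is monochromatic if all points it contains have the same colour. -}

module Defs where

open import Algebra.Bundles.Raw using (RawRing)
open import Data.Fin using (Fin; toℕ)
open import Data.Fin.Subset using (Subset; inside; outside; _∈_; _∉_; _⊆_; _∪_; ∣_∣; ⁅_⁆; ⊥; ⊤)
open import Data.Fin.Subset.Properties using (_⊆?_)
open import Data.List.Base using (List; []; _∷_; _++_; map; filter)
open import Data.List.Extrema.Nat using (max)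
open import Data.Nat.Base using (ℕ; zero; suc; NonZero; _<_)
import Data.Nat.Base as ℕ
open import Data.Nat.DivMod using (_mod_)
open import Data.Nat.Primality using (Prime; prime⇒nonZero)
open import Data.Product using (_×_; ∃-syntax)
open import Data.Refinement using (Refinement; value)
open import Data.Vec.Base using ([]; _∷_)
open import Function.Bundles using (_⇔_)
open import Level using (0ℓ)
open import Relation.Binary.PropositionalEquality using (_≡_; _≢_)
open import Relation.Nullary using (¬_)
open import Relation.Nullary.Decidable using (_×-dec_)
open import Relation.Unary using (Pred; Decidable)
import Algebra.Definitions.RawMonoid as MonoidDefs

-- The ground set is Fin n.  Independence is decidable because a finite
-- matroid is finite data.
record Matroid (n : ℕ) : Set₁ where
  field
    Indep    : Pred (Subset n) 0ℓ
    Indep?   : Decidable Indep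
    empty    : Indep ⊥
    hered    : ∀ {I J} → I ⊆ J → Indep J → Indep I
    exchange : ∀ {I J} → Indep I → Indep J → ∣ I ∣ < ∣ J ∣ →
               ∃[ e ] (e ∈ J × e ∉ I × Indep (I ∪ ⁅ e ⁆))

subsets : ∀ n → List (Subset n)
subsets zero    = [] ∷ []
subsets (suc n) = map (inside ∷_) (subsets n) ++ map (outside ∷_) (subsets n)

module _ {n : ℕ} (M : Matroid n) where
  open Matroid M

  -- The largest size of an independent subset of X.
  rank : Subset n → ℕ
  rank X = max 0 (map ∣_∣ (filter (λ I → Indep? I ×-dec (I ⊆? X)) (subsets n)))

  matroidRank : ℕ
  matroidRank = rank ⊤

  -- F equals its closure { e ∣ rank (F ∪ ⁅ e ⁆) ≡ rank F }.
  IsFlat : Pred (Subset n) 0ℓ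
  IsFlat F = ∀ e → rank (F ∪ ⁅ e ⁆) ≡ rank F → e ∈ F

  IsRankFlat : ℕ → Pred (Subset n) 0ℓ
  IsRankFlat k F = IsFlat F × rank F ≡ k

  Loop : Pred (Fin n) 0ℓ
  Loop e = ¬ Indep ⁅ e ⁆

  Parallel : Fin n → Fin n → Set
  Parallel e f = e ≢ f × ¬ Loop e × ¬ Loop f × ¬ Indep (⁅ e ⁆ ∪ ⁅ f ⁆)

  Simple : Set
  Simple = (∀ e → ¬ Loop e) × (∀ e f → ¬ Parallel e f)

  -- The proof component is irrelevant, so the colour of a point depends
  -- only on its underlying set.
  Point : Set
  Point = Refinement (Subset n) (IsRankFlat 1)

  Monochromatic : (Point → Fin 2) → Pred (Subset n) 0ℓ
  Monochromatic c F = ∀ P Q → value P ⊆ F → value Q ⊆ F → c P ≡ c Q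

-- The integers modulo p; primality of p makes this the field with p elements.
GF : ∀ {p} → Prime p → RawRing 0ℓ 0ℓ
GF {p} pr = record
  { Carrier = Fin p
  ; _≈_     = _≡_
  ; _+_     = λ x y → (toℕ x ℕ.+ toℕ y) mod p
  ; _*_     = λ x y → (toℕ x ℕ.* toℕ y) mod p
  ; -_      = λ x → (p ℕ.∸ toℕ x) mod p
  ; 0#      = 0 mod p
  ; 1#      = 1 mod p
  }
  where
  instance
    p≢0 : NonZero p
    p≢0 = prime⇒nonZero pr

-- The library has no bundle for fields with decidable equality, so linear
-- independence is phrased over raw rings; it is used only for GF.
module _ (K : RawRing 0ℓ 0ℓ) where
  open RawRing K
  open MonoidDefs +-rawMonoid using (sum)

  -- The family of columns of A indexed by X is linearly independent (so two
  -- equal columns with distinct indices are dependent).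
  ColumnsIndependent : ∀ {m n} → (Fin m → Fin n → Carrier) → Subset n → Set
  ColumnsIndependent {m} {n} A X =
    (c : Fin n → Carrier) →
    (∀ e → e ∉ X → c e ≈ 0#) →
    (∀ i → sum (λ e → c e * A i e) ≈ 0#) →
    ∀ e → c e ≈ 0#

  Representable : ∀ {n} → Matroid n → Set
  Representable {n} M =
    ∃[ m ] ∃[ A ] (∀ X → Matroid.Indep M X ⇔ ColumnsIndependent {m} {n} A X)

{-# OPTIONS --safe #-}

-- Colour a vector with 0 if no column of the representation is parallel to it
-- and with the colour of that point otherwise.  The aim is a k-dimensional
-- space with a coloured basis in which only one of the two colours appears.
-- If there is none, every large independent set of coloured vectors has a
-- coloured combination with two nonzero coefficients (otherwise k of its
-- members in one colour span such a space), and by iteration one with many.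
-- Product Ramsey turns this into a coloured combinatorial cube
-- f + Σ t_j d_j, t_j ∈ {0,1}.  Combining many vertices of the cube with
-- constant coefficients, which Hales–Jewett provides, replaces {0,1} by the
-- set of subset sums of p nonzero scalars, and that is all of GF(p): so some
-- affine space f + U is monochromatic.  By Hales–Jewett again, U may be taken
-- to be homogeneous in the three values off 0.  If that value is a colour, U
-- is the desired space, a projective geometry; if it is 0, the coloured
-- vectors in the span of f + U are the multiples of f + U.

module Submission where

open import Defs
open import Data.Fin using (Fin)
open import Data.Nat using (ℕ; _≥_)
open import Data.Nat.Primality using (Prime)
open import Data.Product using (_×_; ∃-syntax)
open import Algebra.Bundles using (CommutativeRing)
open import Algebra.Bundles.Raw using (RawRing)
open import Algebra.Core using (Op₁; Op₂)
import Algebra.Properties.Ring as RingProperties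
import Algebra.Properties.Semiring.Sum as SemiringSum
import Algebra.Solver.Ring.NaturalCoefficients.Default as SemiringSolver
open import Algebra.Structures using (IsCommutativeRing)
import Data.Bool.Properties as Bool
open import Data.Fin.Base using (zero; suc; toℕ; fromℕ<; inject≤; funToFin; finToFun; combine; remQuot; splitAt; join; _↑ʳ_; _↑ˡ_)
open import Data.Fin.Properties using (_≟_; any?; all?; pigeonhole; finToFun-funToFin; <⇒≢; suc-injective; injective⇒≤; inject≤-injective; remQuot-combine; combine-remQuot; splitAt-join; combine-injective; ↑ˡ-injective; ↑ʳ-injective; toℕ-fromℕ<; toℕ-injective; toℕ<n)
open import Data.Fin.Subset using (Subset; inside; outside; _∈_; _∉_; _⊆_; _∪_; ∣_∣; ⁅_⁆; ⊥; ⊤)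
open import Data.Fin.Subset.Properties using (_∈?_; _⊆?_; ∉⊥; ⊥⊆; ∣⊥∣≡0; ∣⁅x⁆∣≡1; x∈⁅x⁆; x∈⁅y⁆⇒x≡y; x∈p∪q⁻; x∈p∪q⁺; ∪-identityʳ; p⊆q⇒∣p∣≤∣q∣; ⊆-antisym; ⊆-refl)
open import Data.Irrelevant using () renaming ([_] to irr)
import Data.List.Base as List
open import Data.List.Extrema.Nat using (argmax-sel; xs≤max)
open import Data.List.Membership.Propositional using () renaming (_∈_ to _∈ˡ_)
open import Data.List.Membership.Propositional.Properties using (∈-map⁺; ∈-map⁻; ∈-++⁺ˡ; ∈-++⁺ʳ; ∈-filter⁺; ∈-filter⁻)
import Data.List.Relation.Unary.All as All
open import Data.List.Relation.Unary.Any using (here)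
open import Data.Maybe.Base using (Maybe; just; nothing; maybe)
import Data.Maybe.Base as Maybe
open import Data.Nat.Base using (zero; suc; _^_; _≤_; _<_; NonZero)
import Data.Nat.Base as ℕ
open import Data.Nat.Coprimality using (prime⇒coprime; coprime-Bézout)
open import Data.Nat.DivMod using (_mod_; _%_; m<n⇒m%n≡m; %-distribˡ-+; %-distribˡ-*; n%n≡0; m*n%n≡0; [m+kn]%n≡m%n)
open import Data.Nat.GCD using (module Bézout)
open import Data.Nat.Primality using (prime⇒nonZero; prime⇒nonTrivial)
import Data.Nat.Properties as ℕ
open import Data.Product using (Σ; ∃; ∃₂; _,_; proj₁; proj₂)
open import Data.Refinement using (value; _,_)
open import Data.Sum.Base using (_⊎_; inj₁; inj₂; [_,_]′)
import Data.Sum.Base as Sum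
open import Data.Vec.Base using (Vec; []; _∷_; _++_; map; lookup; tabulate; replicate; tail; here; there)
open import Data.Vec.Properties using (≡-dec; map-++; map-∘; map-cong; map-id; tabulate∘lookup; tabulate-cong; lookup-map; lookup-++ˡ; lookup-++ʳ; lookup∘tabulate; []=⇒lookup; lookup⇒[]=)
open import Function.Base using (_∘_; id; case_of_)
open import Function.Bundles using (_⇔_; module Equivalence)
open import Function.Definitions using (Injective)
open import Level using (0ℓ)
open import Relation.Binary.Definitions using (DecidableEquality)
open import Relation.Binary.PropositionalEquality using (_≡_; _≢_; _≗_; refl; sym; trans; cong; cong₂; subst; subst₂; isEquivalence; module ≡-Reasoning)
open import Relation.Nullary using (¬_; yes; no; contradiction; Dec; ¬?; does; recompute)
open import Relation.Nullary.Decidable using (_×-dec_; map′; decidable-stable; dec-true)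

-- Hales–Jewett and product Ramsey

-- The points of the matroid may be sparse among all vectors, so a Ramsey theorem for vector spaces
-- applied to the three values may return a space of value 0, which says nothing about the matroid.
-- Hence every stage keeps a basis of coloured vectors at hand: its span either contains the desired
-- space or supplies a richer coloured vector. That vector is not known when a Ramsey theorem is
-- invoked. The theorem is therefore applied not to single colours but to whole patterns: a word
-- determines a space of fixed dimension L, and its colour is the entire colouring of that space,
-- one of 3^(p^L) possibilities. A coloured combination found in one of these spaces then has the
-- same colour in all of them. Exactly p nonzero scalars suffice for the subset sums because each
-- further scalar yields a new sum until all of GF(p) is reached; this needs every nonzero element
-- to generate the additive group, which fails in other finite fields. The spanning coloured vectors
-- of the final space correspond to elements of the matroid, which is what gives the flat rank
-- exactly k.

Word : ℕ → ℕ → Set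
Word q n = Vec (Fin q) n

-- nothing marks the wildcard positions; only active lines have any.
Line : ℕ → ℕ → Set
Line q n = Vec (Maybe (Fin q)) n

Active : ∀ {q n} → Line q n → Set
Active l = ∃[ i ] lookup l i ≡ nothing

infixl 8 _[_]
_[_] : ∀ {q n} → Line q n → Fin q → Word q n
l [ a ] = map (Maybe.fromMaybe a) l

MonoLine : ∀ {q n c} → (Word q n → Fin c) → Set
MonoLine {q} {n} f = Σ (Line q n) λ l → Active l × ∀ a b → f (l [ a ]) ≡ f (l [ b ])

-- A whole colouring becomes one of finitely many colours, so that a Ramsey theorem can be applied
-- to induced colourings.
wordCode : ∀ {q n c} → (Word q n → Fin c) → Fin (c ^ (q ^ n))
wordCode f = funToFin (λ i → f (tabulate (finToFun i)))

wordCode-injective : ∀ {q n c} (f g : Word q n → Fin c) →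
  wordCode f ≡ wordCode g → ∀ w → f w ≡ g w
wordCode-injective f g eq w = begin
  f w                                        ≡⟨ cong f (decode w) ⟨
  f (tabulate (finToFun i))                  ≡⟨ finToFun-funToFin (λ i → f (tabulate (finToFun i))) i ⟨
  finToFun (wordCode f) i                    ≡⟨ cong (λ z → finToFun z i) eq ⟩
  finToFun (wordCode g) i                    ≡⟨ finToFun-funToFin (λ i → g (tabulate (finToFun i))) i ⟩
  g (tabulate (finToFun i))                  ≡⟨ cong g (decode w) ⟩
  g w                                        ∎
  where
  open ≡-Reasoning
  i = funToFin (lookup w)
  decode : ∀ w → tabulate (finToFun (funToFin (lookup w))) ≡ w
  decode w = trans (tabulate-cong (finToFun-funToFin (lookup w))) (tabulate∘lookup w)

-- Letters move up by one so that `zero` stays free: a line over the smaller alphabet controls only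
-- the letters other than the focus.
lift : ∀ {q n} → Line q n → Line (suc q) n
lift = map (Maybe.map suc)

const-line : ∀ {q n} → Word q n → Line q n
const-line = map just

[]-++ : ∀ {q m n} (l : Line q m) (l′ : Line q n) a → (l ++ l′) [ a ] ≡ l [ a ] ++ l′ [ a ]
[]-++ l l′ a = map-++ _ l l′

[]-const : ∀ {q n} (w : Word q n) a → const-line w [ a ] ≡ w
[]-const w a = trans (sym (map-∘ _ just w)) (map-id w)

lift-[suc] : ∀ {q n} (l : Line q n) a → lift l [ suc a ] ≡ map suc (l [ a ])
lift-[suc] l a = begin
  lift l [ suc a ]                                ≡⟨ map-∘ _ _ l ⟨
  map (Maybe.fromMaybe (suc a) ∘ Maybe.map suc) l ≡⟨ map-cong (λ { (just _) → refl ; nothing → refl }) l ⟩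
  map (suc ∘ Maybe.fromMaybe a) l                 ≡⟨ map-∘ _ _ l ⟩
  map suc (l [ a ])                               ∎
  where open ≡-Reasoning

lift-active : ∀ {q n} (l : Line q n) → Active l → Active (lift l)
lift-active l (i , eq) = i , trans (lookup-map i _ l) (cong (Maybe.map suc) eq)

++-activeˡ : ∀ {q m n} (l : Line q m) (l′ : Line q n) → Active l → Active (l ++ l′)
++-activeˡ l l′ (i , eq) = i ↑ˡ _ , trans (lookup-++ˡ l l′ i) eq

-- The colour-focused lines of the standard proof of Hales-Jewett. If the focus itself has one of
-- the r colours, the corresponding line is monochromatic.
record Focused {q n c} (f : Word (suc q) n → Fin c) (r : ℕ) : Set where
  field
    focus       : Word (suc q) n
    line        : Fin r → Line (suc q) n
    active      : ∀ i → Active (line i)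
    focused     : ∀ i → line i [ zero ] ≡ focus
    colour      : Fin r → Fin c
    colour-line : ∀ i a → f (line i [ suc a ]) ≡ colour i
    distinct    : ∀ {i j} → colour i ≡ colour j → i ≡ j

HJ : ℕ → Set
HJ q = ∀ c → ∃[ n ] ∀ (f : Word q n → Fin c) → MonoLine f

module ColourFocusing {q : ℕ} (hj : HJ (suc q)) (c : ℕ) where

  FocusedOrMono : ℕ → Set
  FocusedOrMono r = ∃[ n ] ∀ (f : Word (suc (suc q)) n → Fin c) → MonoLine f ⊎ Focused f r

  -- An initial segment is coloured by the colouring it induces on all tails. A line `l` of such
  -- segments, constant off letter `zero`, leaves a single colouring `f′` of the tails, to which the
  -- case r applies.
  extend : ∀ r → FocusedOrMono r → FocusedOrMono (suc r)
  extend r (n₁ , H₁) = n₂ ℕ.+ n₁ , step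
    where
    n₂ = proj₁ (hj (c ^ (suc (suc q) ^ n₁)))
    step : ∀ (f : Word (suc (suc q)) (n₂ ℕ.+ n₁) → Fin c) → MonoLine f ⊎ Focused f (suc r)
    step f = go (H₁ f′)
      where
      open ≡-Reasoning
      inner : Word (suc q) n₂ → Fin (c ^ (suc (suc q) ^ n₁))
      inner w = wordCode (λ v → f (map suc w ++ v))
      l₀     = proj₁ (proj₂ (hj _) inner)
      l₀-act = proj₁ (proj₂ (proj₂ (hj _) inner))
      l = lift l₀
      l-act = lift-active l₀ l₀-act
      f′ : Word (suc (suc q)) n₁ → Fin c
      f′ v = f (l [ suc zero ] ++ v)
      f-l : ∀ a v → f (l [ suc a ] ++ v) ≡ f′ v
      f-l a v = begin
        f (l [ suc a ] ++ v)             ≡⟨ cong (λ w → f (w ++ v)) (lift-[suc] l₀ a) ⟩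
        f (map suc (l₀ [ a ]) ++ v)      ≡⟨ wordCode-injective _ _ (proj₂ (proj₂ (proj₂ (hj _) inner)) a zero) v ⟩
        f (map suc (l₀ [ zero ]) ++ v)   ≡⟨ cong (λ w → f (w ++ v)) (lift-[suc] l₀ zero) ⟨
        f′ v                             ∎
      mono : MonoLine f′ → MonoLine f
      mono (l′ , act , eq) = const-line (l [ suc zero ]) ++ l′
        , ++-activeʳ act
        , λ a b → trans (cong f (shape a)) (trans (eq a b) (sym (cong f (shape b))))
        where
        shape : ∀ a → (const-line (l [ suc zero ]) ++ l′) [ a ] ≡ l [ suc zero ] ++ l′ [ a ]
        shape a = trans ([]-++ (const-line (l [ suc zero ])) l′ a) (cong (_++ l′ [ a ]) ([]-const _ a))
        ++-activeʳ : Active l′ → Active (const-line (l [ suc zero ]) ++ l′)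
        ++-activeʳ (i , e) = n₂ ↑ʳ i , trans (lookup-++ʳ (const-line (l [ suc zero ])) l′ i) e
      go : MonoLine f′ ⊎ Focused f′ r → MonoLine f ⊎ Focused f (suc r)
      go (inj₁ m) = inj₁ (mono m)
      go (inj₂ F) with any? (λ i → Focused.colour F i ≟ f′ (Focused.focus F))
      ... | yes (i , eq) = inj₁ (mono (line i , active i , λ a b → trans (same a) (sym (same b))))
        where
        open Focused F
        same : ∀ a → f′ (line i [ a ]) ≡ colour i
        same zero    = trans (cong f′ (focused i)) (sym eq)
        same (suc a) = colour-line i a
      -- The additional line moves along `l` with the tail fixed at the old focus. Its colour is
      -- that of the old focus, which is new; the old lines are prolonged by `l` so that all meet in
      -- the new focus.
      ... | no new = inj₂ record
        { focus       = l [ zero ] ++ focus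
        ; line        = line⁺
        ; active      = λ i → ++-activeˡ l (tail⁺ i) l-act
        ; focused     = λ i → trans ([]-++ l (tail⁺ i) zero) (cong (l [ zero ] ++_) (focused⁺ i))
        ; colour      = colour⁺
        ; colour-line = λ i a → trans (cong f ([]-++ l (tail⁺ i) (suc a)))
                                  (trans (f-l a _) (colour-line⁺ i a))
        ; distinct    = distinct⁺
        }
        where
        open Focused F
        tail⁺ : Fin (suc r) → Line (suc (suc q)) n₁
        tail⁺ zero    = const-line focus
        tail⁺ (suc i) = line i
        line⁺ : Fin (suc r) → Line (suc (suc q)) (n₂ ℕ.+ n₁)
        line⁺ i = l ++ tail⁺ i
        focused⁺ : ∀ i → tail⁺ i [ zero ] ≡ focus
        focused⁺ zero    = []-const focus zero
        focused⁺ (suc i) = focused i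
        colour⁺ : Fin (suc r) → Fin c
        colour⁺ zero    = f′ focus
        colour⁺ (suc i) = colour i
        colour-line⁺ : ∀ i a → f′ (tail⁺ i [ suc a ]) ≡ colour⁺ i
        colour-line⁺ zero    a = cong f′ ([]-const focus (suc a))
        colour-line⁺ (suc i) a = colour-line i a
        distinct⁺ : ∀ {i j} → colour⁺ i ≡ colour⁺ j → i ≡ j
        distinct⁺ {zero}  {zero}  _  = refl
        distinct⁺ {zero}  {suc j} eq = contradiction (j , sym eq) new
        distinct⁺ {suc i} {zero}  eq = contradiction (i , eq) new
        distinct⁺ {suc i} {suc j} eq = cong suc (distinct eq)

  focusing : ∀ r → FocusedOrMono r
  focusing zero    = 0 , λ f → inj₂ record
    { focus = [] ; line = λ () ; active = λ () ; focused = λ () ; colour = λ ()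
    ; colour-line = λ () ; distinct = λ { {()} } }
  focusing (suc r) = extend r (focusing r)

-- Induction on the alphabet. With c colours there cannot be c + 1 focused lines of distinct
-- colours, so asking for that many forces a monochromatic line.
hales-jewett : ∀ q → HJ q
hales-jewett zero          c = 1 , λ f → nothing ∷ [] , (zero , refl) , λ ()
hales-jewett (suc zero)    c = 1 , λ f → nothing ∷ [] , (zero , refl) , λ { zero zero → refl }
hales-jewett (suc (suc q)) c with ColourFocusing.focusing (hales-jewett (suc q)) c (suc c)
... | n , H = n , λ f → case H f of λ
  { (inj₁ m) → m
  ; (inj₂ F) → let i , j , i<j , eq = pigeonhole (ℕ.n<1+n c) (Focused.colour F)
               in contradiction (Focused.distinct F eq) (<⇒≢ i<j)
  }

-- Hales–Jewett on words over Fin k, read in base k, is the pigeonhole principle.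
pigeonhole-many : ∀ k c → ∃[ K ] ∀ (f : Fin K → Fin c) →
  Σ (Fin k → Fin K) λ g → Injective _≡_ _≡_ g × (∀ i j → f (g i) ≡ f (g j))
pigeonhole-many k c with hales-jewett k c
... | n , H = k ^ n , λ f → select f (H (f ∘ encode))
  where
  encode : Word k n → Fin (k ^ n)
  encode w = funToFin (lookup w)
  select : ∀ f → MonoLine (f ∘ encode) →
    Σ (Fin k → Fin (k ^ n)) λ g → Injective _≡_ _≡_ g × (∀ i j → f (g i) ≡ f (g j))
  select f (l , (x , eq) , same) = (λ i → encode (l [ i ])) , injective , same
    where
    at-x : ∀ i → finToFun (encode (l [ i ])) x ≡ i
    at-x i = trans (finToFun-funToFin (lookup (l [ i ])) x)
      (trans (lookup-map x _ l) (cong (Maybe.fromMaybe i) eq))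
    injective : ∀ {i j} → encode (l [ i ]) ≡ encode (l [ j ]) → i ≡ j
    injective {i} {j} e = trans (sym (at-x i)) (trans (cong (λ z → finToFun z x) e) (at-x j))

choose : ∀ {A : Set} → A → A → Fin 2 → A
choose x y zero    = x
choose x y (suc _) = y

mix : ∀ {R L} → Word R L → Word R L → Word 2 L → Word R L
mix []      []      []      = []
mix (x ∷ u) (y ∷ v) (b ∷ s) = choose x y b ∷ mix u v s

map-mix : ∀ {R R′ L} (h : Fin R → Fin R′) (u v : Word R L) s →
  map h (mix u v s) ≡ mix (map h u) (map h v) s
map-mix h []      []      []          = refl
map-mix h (x ∷ u) (y ∷ v) (zero  ∷ s) = cong (h x ∷_) (map-mix h u v s)
map-mix h (x ∷ u) (y ∷ v) (suc _ ∷ s) = cong (h y ∷_) (map-mix h u v s)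

lookup-mix : ∀ {R L} (u v : Word R L) s l →
  lookup (mix u v s) l ≡ choose (lookup u l) (lookup v l) (lookup s l)
lookup-mix (x ∷ u) (y ∷ v) (b ∷ s) zero    = refl
lookup-mix (x ∷ u) (y ∷ v) (b ∷ s) (suc l) = lookup-mix u v s l

-- The alphabet is split: the last R letters serve the later coordinates by induction, the first T
-- the first coordinate. T exceeds the number of colourings of the words in the last R letters, so
-- two first letters induce the same colouring.
product-ramsey : ∀ L c → ∃[ R ] ∀ (f : Word R L → Fin c) →
  ∃₂ λ u v → (∀ l → lookup u l ≢ lookup v l) × (∀ s s′ → f (mix u v s) ≡ f (mix u v s′))
product-ramsey zero    c = 0 , λ f → [] , [] , (λ ()) , λ { [] [] → refl }
product-ramsey (suc L) c with product-ramsey L c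
... | R , H = T ℕ.+ R , extend
  where
  T = suc (c ^ (R ^ L))
  up : Fin R → Fin (T ℕ.+ R)
  up = T ↑ʳ_
  extend : ∀ (f : Word (T ℕ.+ R) (suc L) → Fin c) →
    ∃₂ λ u v → (∀ l → lookup u l ≢ lookup v l) × (∀ s s′ → f (mix u v s) ≡ f (mix u v s′))
  extend f
    with pigeonhole (ℕ.n<1+n _) (λ x → wordCode (λ w → f ((x ↑ˡ R) ∷ map up w)))
  ... | x , y , x<y , same
    with H (λ w → f ((x ↑ˡ R) ∷ map up w))
  ...   | u , v , u≢v , uniform =
    (x ↑ˡ R) ∷ map up u , (y ↑ˡ R) ∷ map up v , differ , λ s s′ → trans (toX s) (trans (uniform _ _) (sym (toX s′)))
    where
    differ : ∀ l → lookup ((x ↑ˡ R) ∷ map up u) l ≢ lookup ((y ↑ˡ R) ∷ map up v) l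
    differ zero    eq = <⇒≢ x<y (↑ˡ-injective R x y eq)
    differ (suc l) eq = u≢v l (↑ʳ-injective T _ _
      (trans (sym (lookup-map l up u)) (trans eq (lookup-map l up v))))
    toX : ∀ s → f (mix ((x ↑ˡ R) ∷ map up u) ((y ↑ˡ R) ∷ map up v) s)
                ≡ f ((x ↑ˡ R) ∷ map up (mix u v (tail s)))
    toX (zero  ∷ s) = cong (λ z → f ((x ↑ˡ R) ∷ z)) (sym (map-mix up u v s))
    toX (suc _ ∷ s) = trans (cong (λ z → f ((y ↑ˡ R) ∷ z)) (sym (map-mix up u v s)))
      (sym (wordCode-injective (λ w → f ((x ↑ˡ R) ∷ map up w)) (λ w → f ((y ↑ˡ R) ∷ map up w))
        same (mix u v s)))

-- Vector spaces over a prime field and their colourings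

-- 1-generated is what distinguishes GF(p) among the finite fields; it enters
-- only through the covering of the field by subset sums.
record PrimeField (p : ℕ) : Set₁ where
  infixl 6 _+_
  infixl 7 _*_
  field
    _+_ _*_ : Op₂ (Fin p)
    -_      : Op₁ (Fin p)
    0# 1#   : Fin p
    isCommutativeRing : IsCommutativeRing _≡_ _+_ _*_ -_ 0# 1#
    1≢0     : 1# ≢ 0#
    inverse : ∀ x → x ≢ 0# → ∃[ y ] y * x ≡ 1#
    1-generated : ∀ (P : Fin p → Set) → P 0# → (∀ {x} → P x → P (x + 1#)) → ∀ x → P x

  commutativeRing : CommutativeRing _ _
  commutativeRing = record { isCommutativeRing = isCommutativeRing }

-- Used to search all blocks at once: success in one block ends the proof, otherwise every block
-- contributes its vector.
distribute-⊎ : ∀ {n} {A : Set} {B : Fin n → Set} → (∀ i → A ⊎ B i) → A ⊎ (∀ i → B i)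
distribute-⊎ {zero}  f = inj₂ λ ()
distribute-⊎ {suc n} f with f zero | distribute-⊎ (f ∘ suc)
... | inj₁ a | _      = inj₁ a
... | inj₂ _ | inj₁ a = inj₁ a
... | inj₂ b | inj₂ g = inj₂ λ { zero → b ; (suc i) → g i }

module Linear {p : ℕ} (𝔽 : PrimeField p) where
  open PrimeField 𝔽 public using (1≢0; inverse; 1-generated)
  open CommutativeRing (PrimeField.commutativeRing 𝔽) public
    using (_+_; _*_; -_; 0#; 1#; +-identityˡ; +-identityʳ; -‿inverseʳ; -‿inverseˡ; *-comm; *-assoc;
           *-identityˡ; *-identityʳ; zeroˡ; zeroʳ; distribʳ; commutativeSemiring; semiring; ring)
  open RingProperties ring public using (+-cancelˡ; -‿distribˡ-*; -‿involutive; -0#≈0#)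
  open SemiringSum semiring public
    using (sum; sum-cong-≗; ∑-distrib-+; ∑-comm; *-distribˡ-sum; *-distribʳ-sum; sum-replicate-zero)
  open SemiringSolver commutativeSemiring public using (solve; _:+_; _:*_; _:=_)

  F : Set
  F = Fin p

  V : Set → Set
  V I = I → F

  *-≢0 : ∀ {x y} → x ≢ 0# → x * y ≡ 0# → y ≡ 0#
  *-≢0 {x} {y} x≢0 xy≡0 with z , zx≡1 ← inverse x x≢0 = begin
    y           ≡⟨ *-identityˡ y ⟨
    1# * y      ≡⟨ cong (_* y) zx≡1 ⟨
    z * x * y   ≡⟨ *-assoc z x y ⟩
    z * (x * y) ≡⟨ cong (z *_) xy≡0 ⟩
    z * 0#      ≡⟨ zeroʳ z ⟩
    0#          ∎
    where open ≡-Reasoning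

  inverse-≢0 : ∀ {z a} → z * a ≡ 1# → z ≢ 0#
  inverse-≢0 {a = a} za≡1 refl = 1≢0 (trans (sym za≡1) (zeroˡ a))

  sum-zero : ∀ {n} (f : V (Fin n)) → (∀ i → f i ≡ 0#) → sum f ≡ 0#
  sum-zero {n} f f≡0 = trans (sum-cong-≗ f≡0) (sum-replicate-zero n)

  sum-single : ∀ {n} (f : V (Fin n)) i → (∀ j → j ≢ i → f j ≡ 0#) → sum f ≡ f i
  sum-single f zero    off = trans (cong (f zero +_) (sum-zero (f ∘ suc) λ j → off (suc j) λ ()))
                                   (+-identityʳ _)
  sum-single f (suc i) off = trans (cong₂ _+_ (off zero λ ()) (sum-single (f ∘ suc) i
                                     λ j j≢i → off (suc j) (j≢i ∘ suc-injective)))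
                                   (+-identityˡ _)

  sum-linear : ∀ {n} c (f g : V (Fin n)) → sum (λ i → c * f i + g i) ≡ c * sum f + sum g
  sum-linear c f g = trans (∑-distrib-+ (λ i → c * f i) g) (cong (_+ sum g) (sym (*-distribˡ-sum c f)))

  δ : ∀ {I : Set} → DecidableEquality I → I → V I
  δ _≟ᴵ_ i j with i ≟ᴵ j
  ... | yes _ = 1#
  ... | no _  = 0#

  δ-diag : ∀ {I : Set} (_≟ᴵ_ : DecidableEquality I) {i j} → i ≡ j → δ _≟ᴵ_ i j ≡ 1#
  δ-diag _≟ᴵ_ {i} {j} i≡j with i ≟ᴵ j
  ... | yes _  = refl
  ... | no i≢j = contradiction i≡j i≢j

  δ-off : ∀ {I : Set} (_≟ᴵ_ : DecidableEquality I) {i j} → i ≢ j → δ _≟ᴵ_ i j ≡ 0#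
  δ-off _≟ᴵ_ {i} {j} i≢j with i ≟ᴵ j
  ... | yes i≡j = contradiction i≡j i≢j
  ... | no _    = refl

  e : ∀ {n} → Fin n → V (Fin n)
  e = δ _≟_

  e-diag : ∀ {n} (i : Fin n) → e i i ≡ 1#
  e-diag i = δ-diag _≟_ {i} refl

  e-off : ∀ {n} {i j : Fin n} → i ≢ j → e i j ≡ 0#
  e-off = δ-off _≟_

  sum-e : ∀ {n} (f : V (Fin n)) i → sum (λ j → e i j * f j) ≡ f i
  sum-e f i = trans (sum-single _ i λ j j≢i → trans (cong (_* f j) (e-off (j≢i ∘ sym))) (zeroˡ _))
                    (trans (cong (_* f i) (e-diag i)) (*-identityˡ _))

  sum-e≡1 : ∀ {n} (i : Fin n) → sum (e i) ≡ 1#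
  sum-e≡1 i = trans (sum-single (e i) i λ j j≢i → e-off (j≢i ∘ sym)) (e-diag i)

  infix 4 _⊸_

  -- Vectors are functions compared pointwise, hence `to-cong`. Index types are arbitrary sets so
  -- that a homogenising coordinate can be adjoined as `nothing`.
  record _⊸_ (I J : Set) : Set where
    field
      to        : V I → V J
      to-cong   : ∀ {x y} → x ≗ y → to x ≗ to y
      linear    : ∀ c x y j → to (λ i → c * x i + y i) j ≡ c * to x j + to y j
      injective : ∀ x → (∀ j → to x j ≡ 0#) → ∀ i → x i ≡ 0#

    to-zero : ∀ j → to (λ _ → 0#) j ≡ 0#
    to-zero j = +-cancelˡ (to 0v j) _ _ (begin
      to 0v j + to 0v j                ≡⟨ cong (_+ to 0v j) (*-identityˡ _) ⟨
      1# * to 0v j + to 0v j           ≡⟨ linear 1# 0v 0v j ⟨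
      to (λ _ → 1# * 0# + 0#) j        ≡⟨ to-cong (λ _ → trans (+-identityʳ _) (zeroʳ 1#)) j ⟩
      to 0v j                          ≡⟨ +-identityʳ _ ⟨
      to 0v j + 0#                     ∎)
      where
      open ≡-Reasoning
      0v : V I
      0v _ = 0#

    to-scale : ∀ c x j → to (λ i → c * x i) j ≡ c * to x j
    to-scale c x j = begin
      to (λ i → c * x i) j             ≡⟨ to-cong (λ i → sym (+-identityʳ _)) j ⟩
      to (λ i → c * x i + 0#) j        ≡⟨ linear c x (λ _ → 0#) j ⟩
      c * to x j + to (λ _ → 0#) j     ≡⟨ cong (c * to x j +_) (to-zero j) ⟩
      c * to x j + 0#                  ≡⟨ +-identityʳ _ ⟩
      c * to x j                       ∎
      where open ≡-Reasoning

  open _⊸_ public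

  to-sum : ∀ {I J : Set} {k} (φ : I ⊸ J) (x : V (Fin k)) (z : Fin k → V I) j →
    to φ (λ i → sum (λ s → x s * z s i)) j ≡ sum (λ s → x s * to φ (z s) j)
  to-sum {k = zero}  φ x z j = to-zero φ j
  to-sum {k = suc k} φ x z j = trans (linear φ (x zero) (z zero) _ j)
    (cong (x zero * to φ (z zero) j +_) (to-sum φ (x ∘ suc) (z ∘ suc) j))

  expand : ∀ {J : Set} {k} (φ : Fin k ⊸ J) x j → to φ x j ≡ sum (λ s → x s * to φ (e s) j)
  expand φ x j = trans (to-cong φ (λ i → sym (trans
    (sum-single _ i λ s s≢i → trans (cong (x s *_) (e-off s≢i)) (zeroʳ _))
    (trans (cong (x i *_) (e-diag i)) (*-identityʳ _)))) j) (to-sum φ x e j)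

  infixr 9 _⊚_
  _⊚_ : ∀ {I J K} → J ⊸ K → I ⊸ J → I ⊸ K
  g ⊚ f = record
    { to        = to g ∘ to f
    ; to-cong   = to-cong g ∘ to-cong f
    ; linear    = λ c x y j → trans (to-cong g (linear f c x y) j) (linear g c (to f x) (to f y) j)
    ; injective = λ x → injective f x ∘ injective g (to f x)
    }

  reindex : ∀ {I J : Set} (h : J → I) (s : I → J) → (∀ i → h (s i) ≡ i) → I ⊸ J
  reindex h s hs = record
    { to        = _∘ h
    ; to-cong   = _∘ h
    ; linear    = λ _ _ _ _ → refl
    ; injective = λ x x≡0 i → trans (cong x (sym (hs i))) (x≡0 (s i))
    }

  -- Value 0 marks the vectors outside the matroid, the other two values are
  -- the colours of its points.
  record Colouring (I : Set) : Set where
    field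
      χ       : V I → Fin 3
      χ-cong  : ∀ {x y} → x ≗ y → χ x ≡ χ y
      χ-zero  : χ (λ _ → 0#) ≡ zero
      χ-scale : ∀ {a} → a ≢ 0# → ∀ x → χ (λ i → a * x i) ≡ χ x
  open Colouring public

  pull : ∀ {I J} → Colouring J → I ⊸ J → Colouring I
  pull C f = record
    { χ       = χ C ∘ to f
    ; χ-cong  = χ-cong C ∘ to-cong f
    ; χ-zero  = trans (χ-cong C (to-zero f)) (χ-zero C)
    ; χ-scale = λ {a} a≢0 x → trans (χ-cong C (to-scale f a x)) (χ-scale C a≢0 (to f x))
    }

  -- Value 0 is allowed inside the space but not on the basis: the coloured vectors must span, or
  -- the flat obtained would have too small a rank.
  MonoSubspace : ∀ {I} → ℕ → Colouring I → Set
  MonoSubspace {I} k C = Σ (Fin k ⊸ I) λ φ → ∃[ ρ ]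
    ρ ≢ zero × (∀ i → χ C (to φ (e i)) ≡ ρ) × (∀ x → χ C (to φ x) ≡ zero ⊎ χ C (to φ x) ≡ ρ)

  mono-pull : ∀ {I J k} (C : Colouring J) (f : I ⊸ J) → MonoSubspace k (pull C f) → MonoSubspace k C
  mono-pull C f (φ , rest) = f ⊚ φ , rest

  BasisColoured : ∀ {n} → Colouring (Fin n) → Set
  BasisColoured C = ∀ i → χ C (e i) ≢ zero

  decode-encode : ∀ {n} (x : V (Fin n)) → finToFun (funToFin x) ≗ x
  decode-encode = finToFun-funToFin

  -- There are finitely many vectors. This decides the case distinctions of the proof
  -- constructively.
  anyVector? : ∀ {n} {P : V (Fin n) → Set} → (∀ {x y} → x ≗ y → P x → P y) →
    (∀ x → Dec (P x)) → Dec (∃ P)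
  anyVector? resp P? = map′ (λ (i , Pi) → finToFun i , Pi)
    (λ (x , Px) → funToFin x , resp (λ i → sym (decode-encode x i)) Px) (any? (P? ∘ finToFun))

  -- The entire pattern on an n-dimensional space as a single colour.
  colourCode : ∀ {n} → Colouring (Fin n) → Fin (3 ^ (p ^ n))
  colourCode C = funToFin (χ C ∘ finToFun)

  colourCode-injective : ∀ {n} (C D : Colouring (Fin n)) → colourCode C ≡ colourCode D → ∀ x → χ C x ≡ χ D x
  colourCode-injective C D eq x = begin
    χ C x                            ≡⟨ χ-cong C (decode-encode x) ⟨
    χ C (finToFun i)                 ≡⟨ finToFun-funToFin (χ C ∘ finToFun) i ⟨
    finToFun (colourCode C) i        ≡⟨ cong (λ z → finToFun z i) eq ⟩
    finToFun (colourCode D) i        ≡⟨ finToFun-funToFin (χ D ∘ finToFun) i ⟩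
    χ D (finToFun i)                 ≡⟨ χ-cong D (decode-encode x) ⟩
    χ D x                            ∎
    where
    open ≡-Reasoning
    i = funToFin x

  module _ {k n : ℕ} (g : Fin k → Fin n) (g-inj : Injective _≡_ _≡_ g) where

    private
      extendTo : V (Fin k) → V (Fin n)
      extendTo x j = sum (λ i → e (g i) j * x i)

    extendTo-image : ∀ x i → extendTo x (g i) ≡ x i
    extendTo-image x i = trans
      (sum-single _ i λ i′ i′≢i → trans (cong (_* x i′) (e-off (i′≢i ∘ g-inj))) (zeroˡ _))
      (trans (cong (_* x i) (e-diag (g i))) (*-identityˡ _))

    extendTo-off : ∀ x j → (∀ i → g i ≢ j) → extendTo x j ≡ 0#
    extendTo-off x j off = sum-zero _ λ i → trans (cong (_* x i) (e-off (off i))) (zeroˡ _)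

    extend : Fin k ⊸ Fin n
    extend = record
      { to        = extendTo
      ; to-cong   = λ x≗y j → sum-cong-≗ λ i → cong (e (g i) j *_) (x≗y i)
      ; linear    = λ c x y j → trans (sum-cong-≗ λ i → solve 4 (λ c x y d →
                      d :* (c :* x :+ y) := c :* (d :* x) :+ d :* y) refl c (x i) (y i) (e (g i) j))
                      (sum-linear c (λ i → e (g i) j * x i) (λ i → e (g i) j * y i))
      ; injective = λ x x≡0 i → trans (sym (extendTo-image x i)) (x≡0 (g i))
      }

    extend-e : ∀ i → to extend (e i) ≗ e (g i)
    extend-e i j = trans (sum-cong-≗ λ i′ → *-comm (e (g i′) j) (e i i′)) (sum-e (λ i′ → e (g i′) j) i)

    extend-sum : ∀ x (f : V (Fin n)) → sum (λ j → to extend x j * f j) ≡ sum (λ i → x i * f (g i))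
    extend-sum x f = begin
      sum (λ j → sum (λ i → e (g i) j * x i) * f j)    ≡⟨ sum-cong-≗ (λ j → *-distribʳ-sum (f j) (λ i → e (g i) j * x i)) ⟩
      sum (λ j → sum (λ i → e (g i) j * x i * f j))    ≡⟨ ∑-comm (λ j i → e (g i) j * x i * f j) ⟩
      sum (λ i → sum (λ j → e (g i) j * x i * f j))    ≡⟨ sum-cong-≗ (λ i → sum-cong-≗ λ j →
                                                           solve 3 (λ d x f → d :* x :* f := d :* (x :* f)) refl (e (g i) j) (x i) (f j)) ⟩
      sum (λ i → sum (λ j → e (g i) j * (x i * f j)))  ≡⟨ sum-cong-≗ (λ i → sum-e (λ j → x i * f j) (g i)) ⟩
      sum (λ i → x i * f (g i))                        ∎
      where open ≡-Reasoning

  -- Coloured vectors of large support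

  nonzero? : ∀ x → Dec (x ≢ 0#)
  nonzero? x = ¬? (x ≟ 0#)

  TwoNonzero : ∀ {n} → V (Fin n) → Set
  TwoNonzero x = ∃₂ λ i j → i ≢ j × x i ≢ 0# × x j ≢ 0#

  -- If no coloured vector has two nonzero entries, the coloured vectors are exactly the multiples
  -- of basis vectors, and k + 1 basis vectors of one colour span the desired space.
  coloured-pair : ∀ k → ∃[ K ] ∀ (C : Colouring (Fin K)) → BasisColoured C →
    MonoSubspace (suc k) C ⊎ ∃[ x ] TwoNonzero x × χ C x ≢ zero
  coloured-pair k with pigeonhole-many (suc k) 3
  ... | K , H = K , find
    where
    find : ∀ (C : Colouring (Fin K)) → BasisColoured C →
      MonoSubspace (suc k) C ⊎ ∃[ x ] TwoNonzero x × χ C x ≢ zero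
    find C basis with anyVector? {P = λ x → TwoNonzero x × χ C x ≢ zero}
        (λ { eq ((i , j , i≢j , xi , xj) , c) → (i , j , i≢j , xi ∘ trans (eq i) , xj ∘ trans (eq j)) , c ∘ trans (χ-cong C eq) })
        (λ x → any? (λ i → any? λ j → ¬? (i ≟ j) ×-dec nonzero? (x i) ×-dec nonzero? (x j)) ×-dec ¬? (χ C x ≟ zero))
    ... | yes (x , two , c) = inj₂ (x , two , c)
    ... | no none with H (χ C ∘ e)
    ...   | g , g-inj , same = inj₁ (φ , χ C (e (g zero)) , basis (g zero) , on-basis , on-span)
      where
      φ = extend g g-inj
      on-basis : ∀ i → χ C (to φ (e i)) ≡ χ C (e (g zero))
      on-basis i = trans (χ-cong C (extend-e g g-inj i)) (same i zero)
      single : ∀ x i → x i ≢ 0# → χ C (to φ x) ≢ zero → ∀ j → j ≢ i → x j ≡ 0#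
      single x i xi≢0 c j j≢i = decidable-stable (x j ≟ 0#) λ xj≢0 → none
        (to φ x , (g i , g j , j≢i ∘ sym ∘ g-inj , xi≢0 ∘ trans (sym (extendTo-image g g-inj x i))
                             , xj≢0 ∘ trans (sym (extendTo-image g g-inj x j))) , c)
      on-span : ∀ x → χ C (to φ x) ≡ zero ⊎ χ C (to φ x) ≡ χ C (e (g zero))
      on-span x with χ C (to φ x) ≟ zero
      ... | yes c≡0 = inj₁ c≡0
      ... | no  c≢0 with any? (λ i → nonzero? (x i))
      ...   | no  x≡0 = contradiction (trans (χ-cong C (to-cong φ λ i → decidable-stable (x i ≟ 0#) λ xi → x≡0 (i , xi)))
                                             (trans (χ-cong C (to-zero φ)) (χ-zero C))) c≢0
      ...   | yes (i , xi≢0) = inj₂ (begin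
        χ C (to φ x)                        ≡⟨ χ-cong C (to-cong φ multiple) ⟩
        χ C (to φ (λ j → x i * e i j))      ≡⟨ χ-cong C (to-scale φ (x i) (e i)) ⟩
        χ C (λ j → x i * to φ (e i) j)      ≡⟨ χ-scale C xi≢0 (to φ (e i)) ⟩
        χ C (to φ (e i))                    ≡⟨ on-basis i ⟩
        χ C (e (g zero))                    ∎)
        where
        open ≡-Reasoning
        multiple : ∀ j → x j ≡ x i * e i j
        multiple j with i ≟ j
        ... | yes refl = sym (*-identityʳ _)
        ... | no  i≢j  = trans (single x i xi≢0 c≢0 j (i≢j ∘ sym)) (sym (zeroʳ _))

  Support≥ : ∀ {n} → ℕ → V (Fin n) → Set
  Support≥ {n} m x = Σ (Fin m → Fin n) λ g → Injective _≡_ _≡_ g × (∀ i → x (g i) ≢ 0#)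

  module _ {K L : ℕ} where

    block : Fin K → Fin L ⊸ Fin (K ℕ.* L)
    block i = record
      { to        = λ x j → let i′ , l = remQuot {K} L j in e i i′ * x l
      ; to-cong   = λ x≗y j → let i′ , l = remQuot {K} L j in cong (e i i′ *_) (x≗y l)
      ; linear    = λ c x y j → let i′ , l = remQuot {K} L j in solve 4 (λ c x y d →
                      d :* (c :* x :+ y) := c :* (d :* x) :+ d :* y) refl c (x l) (y l) (e i i′)
      ; injective = λ x x≡0 l → trans (sym (trans
                      (cong (λ (i′ , l′) → e i i′ * x l′) (remQuot-combine i l))
                      (trans (cong (_* x l) (e-diag i)) (*-identityˡ _))))
                      (x≡0 (combine i l))
      }

    block-e : ∀ i l → to (block i) (e l) ≗ e (combine i l)
    block-e i l j = trans (go _ _) (cong (e (combine i l)) (combine-remQuot {K} L j))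
      where
      go : ∀ i′ l′ → e i i′ * e l l′ ≡ e (combine i l) (combine i′ l′)
      go i′ l′ with i ≟ i′ | l ≟ l′
      ... | yes refl | yes refl = trans (*-identityˡ _) (sym (e-diag (combine i l)))
      ... | yes refl | no l≢l′  = trans (zeroʳ _) (sym (e-off (l≢l′ ∘ proj₂ ∘ combine-injective i l i l′)))
      ... | no i≢i′  | _        = trans (zeroˡ _) (sym (e-off (i≢i′ ∘ proj₁ ∘ combine-injective i l i′ l′)))

    -- One vector per block, taken as a new basis. Disjoint blocks keep the new basis independent
    -- and let supports add up.
    spread : (v : Fin K → V (Fin L)) → (∀ i → ∃[ l ] v i l ≢ 0#) → Fin K ⊸ Fin (K ℕ.* L)
    spread v v≢0 = record
      { to        = λ x j → let i , l = remQuot {K} L j in v i l * x i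
      ; to-cong   = λ x≗y j → let i , l = remQuot {K} L j in cong (v i l *_) (x≗y i)
      ; linear    = λ c x y j → let i , l = remQuot {K} L j in solve 4 (λ c x y d →
                      d :* (c :* x :+ y) := c :* (d :* x) :+ d :* y) refl c (x i) (y i) (v i l)
      ; injective = λ x x≡0 i → let l , vil≢0 = v≢0 i in *-≢0 vil≢0
                      (trans (cong (λ (i′ , l′) → v i′ l′ * x i′) (sym (remQuot-combine i l))) (x≡0 (combine i l)))
      }

    spread-e : ∀ v v≢0 i → to (spread v v≢0) (e i) ≗ to (block i) (v i)
    spread-e v v≢0 i j = go (proj₁ (remQuot {K} L j)) (proj₂ (remQuot {K} L j))
      where
      go : ∀ i′ l → v i′ l * e i i′ ≡ e i i′ * v i l
      go i′ l with i ≟ i′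
      ... | yes refl = *-comm _ _
      ... | no _     = trans (zeroʳ _) (sym (zeroˡ _))

  -- Each of K blocks supplies a coloured vector of support m + 1. These form a coloured basis, so
  -- some combination of at least two of them is coloured again, and its support is larger.
  coloured-support : ∀ k m → ∃[ L ] ∀ (C : Colouring (Fin L)) → BasisColoured C →
    MonoSubspace (suc k) C ⊎ ∃[ x ] Support≥ (suc m) x × χ C x ≢ zero
  coloured-support k zero = 1 , λ C basis → inj₂
    (e zero , ((λ _ → zero) , (λ { {zero} {zero} _ → refl }) , λ _ → 1≢0) , basis zero)
  coloured-support k (suc m) with coloured-pair k | coloured-support k m
  ... | K , pair | L , IH = K ℕ.* L , find
    where
    Supported : ∀ {n} → ℕ → Colouring (Fin n) → Set
    Supported m C = ∃[ x ] Support≥ (suc m) x × χ C x ≢ zero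
    find : ∀ (C : Colouring (Fin (K ℕ.* L))) → BasisColoured C → MonoSubspace (suc k) C ⊎ Supported (suc m) C
    find C basis
      with distribute-⊎ (λ i → Sum.map₁ (mono-pull {k = suc k} C (block i)) (IH (pull C (block i))
             λ l → basis (combine i l) ∘ trans (sym (χ-cong C (block-e i l)))))
    ... | inj₁ win = inj₁ win
    ... | inj₂ vs  = Sum.map (mono-pull {k = suc k} C s) enlarge
                       (pair (pull C s) λ i → proj₂ (proj₂ (vs i)) ∘ trans (sym (χ-cong C (spread-e v v≢0 i))))
      where
      v : Fin K → V (Fin L)
      v i = proj₁ (vs i)
      g : Fin K → Fin (suc m) → Fin L
      g i = proj₁ (proj₁ (proj₂ (vs i)))
      v≢0 : ∀ i → ∃[ l ] v i l ≢ 0#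
      v≢0 i = g i zero , proj₂ (proj₂ (proj₁ (proj₂ (vs i)))) zero
      s = spread v v≢0
      enlarge : ∃[ x ] TwoNonzero x × χ C (to s x) ≢ zero → Supported (suc m) C
      enlarge (x , (i₁ , i₂ , i₁≢i₂ , x₁ , x₂) , c) = to s x , (g⁺ , g⁺-inj , supported) , c
        where
        -- All known entries of block `i₁` and a single one of block `i₂`: growth by one is enough.
        g⁺ : Fin (suc (suc m)) → Fin (K ℕ.* L)
        g⁺ zero    = combine i₂ (g i₂ zero)
        g⁺ (suc j) = combine i₁ (g i₁ j)
        g⁺-inj : Injective _≡_ _≡_ g⁺
        g⁺-inj {zero}  {zero}  _  = refl
        g⁺-inj {zero}  {suc j} eq = contradiction (sym (proj₁ (combine-injective i₂ _ i₁ _ eq))) i₁≢i₂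
        g⁺-inj {suc i} {zero}  eq = contradiction (proj₁ (combine-injective i₁ _ i₂ _ eq)) i₁≢i₂
        g⁺-inj {suc i} {suc j} eq = cong suc (proj₁ (proj₂ (proj₁ (proj₂ (vs i₁)))) (proj₂ (combine-injective i₁ _ i₁ _ eq)))
        entry : ∀ i j → x i ≢ 0# → to s x (combine i (g i j)) ≢ 0#
        entry i j xi≢0 eq = xi≢0 (*-≢0 (proj₂ (proj₂ (proj₁ (proj₂ (vs i)))) j)
          (trans (cong (λ (i′ , l) → v i′ l * x i′) (sym (remQuot-combine i (g i j)))) eq))
        supported : ∀ j → to s x (g⁺ j) ≢ 0#
        supported zero    = entry i₂ zero x₂
        supported (suc j) = entry i₁ j x₁

-- Ramsey theory for colourings of vector spaces

module Ramsey {p : ℕ} (𝔽 : PrimeField p) where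
  open Linear 𝔽

  -- The coordinate `nothing` homogenises: an injection on `Maybe I` encodes an affine space, with
  -- base point the image of the unit vector at `nothing` and directions the images of the other
  -- unit vectors.
  point : ∀ {I : Set} → V I → V (Maybe I)
  point y = maybe y 1#

  bit : Fin 2 → F
  bit = choose 0# 1#

  CubeColoured : ∀ {I} → Colouring (Maybe I) → Set
  CubeColoured {I} C = ∃[ ρ ] ρ ≢ zero × (∀ (s : I → Fin 2) → χ C (point (bit ∘ s)) ≡ ρ)

  -- The coordinates form L blocks of R; a word selects one unit vector from each block.
  transversal : ∀ {R L} → Word R L → Fin L ⊸ Fin (L ℕ.* R)
  transversal {R} {L} a = record
    { to        = λ x j → let l , b = remQuot {L} R j in e (lookup a l) b * x l
    ; to-cong   = λ x≗y j → let l , b = remQuot {L} R j in cong (e (lookup a l) b *_) (x≗y l)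
    ; linear    = λ c x y j → let l , b = remQuot {L} R j in solve 4 (λ c x y d →
                    d :* (c :* x :+ y) := c :* (d :* x) :+ d :* y) refl c (x l) (y l) (e (lookup a l) b)
    ; injective = λ x x≡0 l → trans (sym (trans
                    (cong (λ (l′ , b) → e (lookup a l′) b * x l′) (remQuot-combine {L} {R} l (lookup a l)))
                    (trans (cong (_* x l) (e-diag (lookup a l))) (*-identityˡ _))))
                    (x≡0 (combine l (lookup a l)))
    }

  transversal-e : ∀ {R L} (a : Word R L) l → to (transversal a) (e l) ≗ e (combine l (lookup a l))
  transversal-e {R} {L} a l j = trans (go (proj₁ (remQuot {L} R j)) (proj₂ (remQuot {L} R j)))
                                      (cong (e (combine l (lookup a l))) (combine-remQuot {L} R j))
    where
    go : ∀ l′ b → e (lookup a l′) b * e l l′ ≡ e (combine l (lookup a l)) (combine l′ b)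
    go l′ b with l ≟ l′ | lookup a l′ ≟ b
    ... | yes refl | yes refl = trans (*-identityˡ _) (sym (e-diag (combine l (lookup a l))))
    ... | yes refl | no a≢b   = trans (zeroˡ _) (sym (e-off (a≢b ∘ proj₂ ∘ combine-injective l (lookup a l) l b)))
    ... | no l≢l′  | _        = trans (zeroʳ _) (sym (e-off (l≢l′ ∘ proj₁ ∘ combine-injective l (lookup a l) l′ b)))

  -- Moves along u l - v l, weighted by x l, at m of the coordinates l in the
  -- support of x; one more coordinate of the support is left at u l, so that
  -- the base point is independent of the directions.
  module Switch {R L m : ℕ} (u v : Word R L) (u≢v : ∀ l → lookup u l ≢ lookup v l)
                (x : V (Fin L)) (supp : Support≥ (suc m) x) where
    g : Fin (suc m) → Fin L
    g = proj₁ supp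

    g-inj : Injective _≡_ _≡_ g
    g-inj = proj₁ (proj₂ supp)

    x≢0 : ∀ i → x (g i) ≢ 0#
    x≢0 = proj₂ (proj₂ supp)

    moved : Fin m ⊸ Fin L
    moved = extend (g ∘ suc) (suc-injective ∘ g-inj)

    entry : V (Maybe (Fin m)) → Fin L → Fin R → F
    entry y l b = x l * (e (lookup u l) b * y nothing
                         + (e (lookup v l) b + - e (lookup u l) b) * to moved (y ∘ just) l)

    -- Since u and v differ at l, the base point vanishes in this coordinate, which thus isolates
    -- the movement.
    entry-v : ∀ y l → entry y l (lookup v l) ≡ x l * to moved (y ∘ just) l
    entry-v y l = cong (x l *_) (begin
      e u′ v′ * y nothing + (e v′ v′ + - e u′ v′) * t
        ≡⟨ cong₂ (λ a b → a * y nothing + (b + - a) * t) (e-off (u≢v l)) (e-diag v′) ⟩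
      0# * y nothing + (1# + - 0#) * t                 ≡⟨ cong₂ (λ a b → a + (1# + b) * t) (zeroˡ _) -0#≈0# ⟩
      0# + (1# + 0#) * t                               ≡⟨ +-identityˡ _ ⟩
      (1# + 0#) * t                                    ≡⟨ cong (_* t) (+-identityʳ 1#) ⟩
      1# * t                                           ≡⟨ *-identityˡ t ⟩
      t                                                ∎)
      where
      open ≡-Reasoning
      u′ = lookup u l
      v′ = lookup v l
      t  = to moved (y ∘ just) l

    -- The reserved block `g zero` never moves, so it isolates the homogenising coordinate.
    entry-u : ∀ y → entry y (g zero) (lookup u (g zero)) ≡ x (g zero) * y nothing
    entry-u y = cong (x (g zero) *_) (begin
      e u′ u′ * y nothing + d * to moved (y ∘ just) (g zero)  ≡⟨ cong₂ (λ a b → a * y nothing + d * b) (e-diag u′)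
                                                                   (extendTo-off (g ∘ suc) (suc-injective ∘ g-inj) (y ∘ just) (g zero)
                                                                     (λ i eq → case g-inj eq of λ ())) ⟩
      1# * y nothing + d * 0#                                 ≡⟨ cong₂ _+_ (*-identityˡ _) (zeroʳ d) ⟩
      y nothing + 0#                                          ≡⟨ +-identityʳ _ ⟩
      y nothing                                               ∎)
      where
      open ≡-Reasoning
      u′ = lookup u (g zero)
      d  = e (lookup v (g zero)) u′ + - e u′ u′

    switch : Maybe (Fin m) ⊸ Fin (L ℕ.* R)
    switch = record
      { to        = λ y j → let l , b = remQuot {L} R j in entry y l b
      ; to-cong   = λ x≗y j → let l , b = remQuot {L} R j in
                      cong (x l *_) (cong₂ _+_ (cong (_ *_) (x≗y nothing)) (cong (_ *_) (to-cong moved (x≗y ∘ just) l)))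
      ; linear    = λ c y y′ j → let l , b = remQuot {L} R j
                                     t  = to moved (y ∘ just) l
                                     t′ = to moved (y′ ∘ just) l
                                     a  = e (lookup u l) b
                                     d  = e (lookup v l) b + - e (lookup u l) b
                    in trans (cong (λ z → x l * (a * (c * y nothing + y′ nothing) + d * z))
                                   (linear moved c (y ∘ just) (y′ ∘ just) l))
                         (solve 8 (λ c y y′ t t′ a d x →
                            x :* (a :* (c :* y :+ y′) :+ d :* (c :* t :+ t′)) :=
                            c :* (x :* (a :* y :+ d :* t)) :+ x :* (a :* y′ :+ d :* t′))
                          refl c (y nothing) (y′ nothing) t t′ a d (x l))
      ; injective = inj
      }
      where
      inj : ∀ y → (∀ j → (let l , b = remQuot {L} R j in entry y l b) ≡ 0#) → ∀ i → y i ≡ 0#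
      inj y y≡0 nothing = *-≢0 (x≢0 zero) (trans (sym (entry-u y))
        (trans (cong (λ (l , b) → entry y l b) (sym (remQuot-combine {L} {R} (g zero) (lookup u (g zero)))))
               (y≡0 (combine (g zero) (lookup u (g zero))))))
      inj y y≡0 (just i) = trans (sym (extendTo-image (g ∘ suc) (suc-injective ∘ g-inj) (y ∘ just) i))
        (*-≢0 (x≢0 (suc i)) (trans (sym (entry-v y l))
          (trans (cong (λ (l , b) → entry y l b) (sym (remQuot-combine {L} {R} l (lookup v l))))
                 (y≡0 (combine l (lookup v l))))))
        where l = g (suc i)

    moved-bit : ∀ (s : Fin m → Fin 2) l → ∃[ b ] to moved (bit ∘ s) l ≡ bit b
    moved-bit s l with any? (λ i → g (suc i) ≟ l)
    ... | yes (i , refl) = s i , extendTo-image (g ∘ suc) (suc-injective ∘ g-inj) (bit ∘ s) i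
    ... | no off         = zero , extendTo-off (g ∘ suc) (suc-injective ∘ g-inj) (bit ∘ s) l (λ i eq → off (i , eq))

    -- A vertex of the cube replaces u by v in some of the blocks, hence is `x` carried by the
    -- transversal of a mixture.
    switch-point : ∀ (s : Fin m → Fin 2) →
      ∃[ s′ ] to switch (point (bit ∘ s)) ≗ to (transversal (mix u v s′)) x
    switch-point s = s′ , λ j → go (proj₁ (remQuot {L} R j)) (proj₂ (remQuot {L} R j))
      where
      s′ : Word 2 L
      s′ = tabulate (proj₁ ∘ moved-bit s)
      combination : ∀ c (a d : F) → a * 1# + (d + - a) * bit c ≡ choose a d c
      combination zero    a d = trans (cong₂ _+_ (*-identityʳ a) (zeroʳ _)) (+-identityʳ a)
      combination (suc _) a d = begin
        a * 1# + (d + - a) * 1#  ≡⟨ cong₂ _+_ (*-identityʳ a) (*-identityʳ _) ⟩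
        a + (d + - a)            ≡⟨ solve 3 (λ a d m → a :+ (d :+ m) := d :+ (a :+ m)) refl a d (- a) ⟩
        d + (a + - a)            ≡⟨ cong (d +_) (-‿inverseʳ a) ⟩
        d + 0#                   ≡⟨ +-identityʳ d ⟩
        d                        ∎
        where open ≡-Reasoning
      choose-e : ∀ c (a d b : Fin R) → choose (e a b) (e d b) c ≡ e (choose a d c) b
      choose-e zero    a d b = refl
      choose-e (suc _) a d b = refl
      go : ∀ l b → entry (point (bit ∘ s)) l b ≡ e (lookup (mix u v s′) l) b * x l
      go l b = begin
        x l * (e u′ b * 1# + (e v′ b + - e u′ b) * to moved (bit ∘ s) l)
          ≡⟨ cong (λ z → x l * (e u′ b * 1# + (e v′ b + - e u′ b) * z)) (proj₂ (moved-bit s l)) ⟩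
        x l * (e u′ b * 1# + (e v′ b + - e u′ b) * bit c)
          ≡⟨ cong (x l *_) (combination c (e u′ b) (e v′ b)) ⟩
        x l * choose (e u′ b) (e v′ b) c                                  ≡⟨ cong (x l *_) (choose-e c u′ v′ b) ⟩
        x l * e (choose u′ v′ c) b
          ≡⟨ cong (λ z → x l * e (choose u′ v′ z) b) (lookup∘tabulate (proj₁ ∘ moved-bit s) l) ⟨
        x l * e (choose u′ v′ (lookup s′ l)) b                            ≡⟨ cong (λ z → x l * e z b) (lookup-mix u v s′ l) ⟨
        x l * e (lookup (mix u v s′) l) b                                 ≡⟨ *-comm _ _ ⟩
        e (lookup (mix u v s′) l) b * x l                                 ∎
        where
        open ≡-Reasoning
        u′ = lookup u l
        v′ = lookup v l
        c  = proj₁ (moved-bit s l)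

  coloured-cube : ∀ k m → ∃[ N ] ∀ (C : Colouring (Fin N)) → BasisColoured C →
    MonoSubspace (suc k) C ⊎ Σ (Maybe (Fin m) ⊸ Fin N) λ ψ → CubeColoured (pull C ψ)
  coloured-cube k m with coloured-support k m
  ... | L , support with product-ramsey L (3 ^ (p ^ L))
  ...   | R , ramsey = L ℕ.* R , find
    where
    find : ∀ (C : Colouring (Fin (L ℕ.* R))) → BasisColoured C →
      MonoSubspace (suc k) C ⊎ Σ (Maybe (Fin m) ⊸ Fin (L ℕ.* R)) λ ψ → CubeColoured (pull C ψ)
    -- Words are coloured by the pattern on their transversal, so the `x` found later for `a₀` has
    -- the same colour on every mixture.
    find C basis with ramsey (λ a → colourCode (pull C (transversal a)))
    ... | u , v , u≢v , uniform = Sum.map (mono-pull {k = suc k} C (transversal a₀)) cube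
          (support (pull C (transversal a₀)) λ l → basis (combine l (lookup a₀ l))
             ∘ trans (sym (χ-cong C (transversal-e a₀ l))))
      where
      a₀ : Word R L
      a₀ = mix u v (replicate L zero)
      cube : ∃[ x ] Support≥ (suc m) x × χ C (to (transversal a₀) x) ≢ zero →
        Σ (Maybe (Fin m) ⊸ Fin (L ℕ.* R)) λ ψ → CubeColoured (pull C ψ)
      cube (x , supp , c) = switch , χ C (to (transversal a₀) x) , c , λ s →
        trans (χ-cong C (proj₂ (switch-point s)))
              (colourCode-injective (pull C (transversal (mix u v (proj₁ (switch-point s))))) (pull C (transversal a₀))
                (uniform _ _) x)
        where open Switch u v u≢v x supp

  -- Subset sums in a prime field

  subset-sum : ∀ {K} → V (Fin K) → (Fin K → Fin 2) → F
  subset-sum x s = sum (λ i → bit (s i) * x i)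

  -- As long as the subset sums of x do not exhaust the field, a further
  -- nonzero entry d of x produces a new one: a set of sums closed under
  -- adding d contains all multiples of d, hence everything.
  module SubsetSums {K m : ℕ} (x : V (Fin K)) (supp : Support≥ m x) where
    g : Fin m → Fin K
    g = proj₁ supp

    All : Set
    All = ∀ t → ∃[ s ] subset-sum x s ≡ t

    record Distinct (n : ℕ) : Set where
      field
        sets     : Fin (suc n) → Fin K → Fin 2
        distinct : ∀ {u v} → subset-sum x (sets u) ≡ subset-sum x (sets v) → u ≡ v
        unused   : ∀ u j → n ≤ toℕ j → sets u (g j) ≡ zero

    insert : Fin K → (Fin K → Fin 2) → Fin K → Fin 2
    insert i s j with i ≟ j
    ... | yes _ = suc zero
    ... | no _  = s j

    insert-off : ∀ {i j} s → i ≢ j → insert i s j ≡ s j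
    insert-off {i} {j} s i≢j with i ≟ j
    ... | yes i≡j = contradiction i≡j i≢j
    ... | no _    = refl

    insert-sum : ∀ i s → s i ≡ zero → subset-sum x (insert i s) ≡ subset-sum x s + x i
    insert-sum i s si≡0 = begin
      sum (λ j → bit (insert i s j) * x j)                     ≡⟨ sum-cong-≗ pointwise ⟩
      sum (λ j → bit (s j) * x j + e i j * x j)                ≡⟨ ∑-distrib-+ (λ j → bit (s j) * x j) (λ j → e i j * x j) ⟩
      subset-sum x s + sum (λ j → e i j * x j)                 ≡⟨ cong (subset-sum x s +_) (sum-e x i) ⟩
      subset-sum x s + x i                                     ∎
      where
      open ≡-Reasoning
      pointwise : ∀ j → bit (insert i s j) * x j ≡ bit (s j) * x j + e i j * x j
      pointwise j with i ≟ j
      ... | yes refl rewrite si≡0 = sym (trans (cong (_+ 1# * x i) (zeroˡ (x i))) (+-identityˡ _))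
      ... | no _ = sym (trans (cong (bit (s j) * x j +_) (zeroˡ (x j))) (+-identityʳ _))

    grow : ∀ {n} → n < m → Distinct n → All ⊎ Distinct (suc n)
    grow {n} n<m D with any? (λ u → ¬? (any? λ v →
        subset-sum x (Distinct.sets D v) ≟ subset-sum x (Distinct.sets D u) + x (g (fromℕ< n<m))))
    ... | yes (u , new) = inj₂ record { sets = sets⁺ ; distinct = distinct⁺ ; unused = unused⁺ }
      where
      open Distinct D
      j₀ = fromℕ< n<m
      sum-new : subset-sum x (insert (g j₀) (sets u)) ≡ subset-sum x (sets u) + x (g j₀)
      sum-new = insert-sum (g j₀) (sets u) (unused u j₀ (ℕ.≤-reflexive (sym (toℕ-fromℕ< n<m))))
      sets⁺ : Fin (suc (suc n)) → Fin K → Fin 2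
      sets⁺ zero    = insert (g j₀) (sets u)
      sets⁺ (suc v) = sets v
      distinct⁺ : ∀ {v w} → subset-sum x (sets⁺ v) ≡ subset-sum x (sets⁺ w) → v ≡ w
      distinct⁺ {zero}  {zero}  _  = refl
      distinct⁺ {zero}  {suc w} eq = contradiction (w , trans (sym eq) sum-new) new
      distinct⁺ {suc v} {zero}  eq = contradiction (v , trans eq sum-new) new
      distinct⁺ {suc v} {suc w} eq = cong suc (distinct eq)
      unused⁺ : ∀ v j → suc n ≤ toℕ j → sets⁺ v (g j) ≡ zero
      unused⁺ (suc v) j n<j = unused v j (ℕ.<⇒≤ n<j)
      unused⁺ zero    j n<j = trans (insert-off (sets u) λ eq → ℕ.<⇒≢ n<j
        (trans (sym (toℕ-fromℕ< n<m)) (cong toℕ (proj₁ (proj₂ supp) eq))))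
        (unused u j (ℕ.<⇒≤ n<j))
    ... | no closed = inj₁ all
      where
      open Distinct D
      open ≡-Reasoning
      d = x (g (fromℕ< n<m))
      base = subset-sum x (sets zero)
      d⁻¹ = proj₁ (inverse d (proj₂ (proj₂ supp) _))
      multiples : ∀ z → ∃[ v ] subset-sum x (sets v) ≡ base + z * d
      multiples = 1-generated _ (zero , sym (trans (cong (base +_) (zeroˡ d)) (+-identityʳ base)))
        λ {z} (v , eq) →
          let w , eq′ = decidable-stable (any? λ w → subset-sum x (sets w) ≟ subset-sum x (sets v) + d)
                                         (λ none → closed (v , none)) in
          w , (begin
            subset-sum x (sets w)        ≡⟨ eq′ ⟩
            subset-sum x (sets v) + d    ≡⟨ cong (_+ d) eq ⟩
            base + z * d + d             ≡⟨ cong (base + z * d +_) (*-identityˡ d) ⟨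
            base + z * d + 1# * d
              ≡⟨ solve 4 (λ b z d o → b :+ z :* d :+ o :* d := b :+ (z :+ o) :* d) refl base z d 1# ⟩
            base + (z + 1#) * d          ∎)
      all : All
      all t = let v , eq = multiples ((t + - base) * d⁻¹) in sets v , (begin
        subset-sum x (sets v)               ≡⟨ eq ⟩
        base + (t + - base) * d⁻¹ * d       ≡⟨ cong (base +_) (*-assoc _ d⁻¹ d) ⟩
        base + (t + - base) * (d⁻¹ * d)     ≡⟨ cong (λ z → base + (t + - base) * z) (proj₂ (inverse d _)) ⟩
        base + (t + - base) * 1#            ≡⟨ cong (base +_) (*-identityʳ _) ⟩
        base + (t + - base)                 ≡⟨ solve 3 (λ b t m → b :+ (t :+ m) := t :+ (b :+ m)) refl base t (- base) ⟩
        t + (base + - base)                 ≡⟨ cong (t +_) (-‿inverseʳ base) ⟩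
        t + 0#                              ≡⟨ +-identityʳ t ⟩
        t                                   ∎)

    reach : ∀ n → n ≤ m → All ⊎ Distinct n
    reach zero    _   = inj₂ record
      { sets = λ _ _ → zero ; distinct = λ { {zero} {zero} _ → refl } ; unused = λ _ _ _ → refl }
    reach (suc n) n<m with reach n (ℕ.<⇒≤ n<m)
    ... | inj₁ all = inj₁ all
    ... | inj₂ D   = grow n<m D

  -- Were the field not exhausted, p additions would produce p + 1 distinct sums among p elements.
  subset-sums-cover : ∀ {K m} (x : V (Fin K)) → Support≥ m x → p ≤ m → ∀ t → ∃[ s ] subset-sum x s ≡ t
  subset-sums-cover x supp p≤m with SubsetSums.reach x supp p p≤m
  ... | inj₁ all = all
  ... | inj₂ D   = contradiction (injective⇒≤ (SubsetSums.Distinct.distinct D)) ℕ.1+n≰n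

  -- From cubes to affine spaces

  AffineColoured : ∀ {I} → Colouring (Maybe I) → Set
  AffineColoured {I} C = ∃[ ρ ] ρ ≢ zero × (∀ y → χ C (point y) ≡ ρ)

  -- A line over the alphabet of m-tuples is an m-dimensional affine space:
  -- at a wildcard position the m coordinates run freely, at any other they
  -- are a constant multiple of the homogenising coordinate.
  substitute : ∀ {q n m} (val : Fin q → V (Fin m)) → Line q n → V (Maybe (Fin m)) → Fin n → Fin m → F
  substitute val l y x j = maybe (λ a → val a j * y nothing) (y (just j)) (lookup l x)

  substitute-linear : ∀ {q n m} (val : Fin q → V (Fin m)) (l : Line q n) c y y′ x j →
    substitute val l (λ i → c * y i + y′ i) x j ≡ c * substitute val l y x j + substitute val l y′ x j
  substitute-linear val l c y y′ x j with lookup l x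
  ... | nothing = refl
  ... | just a  = solve 4 (λ c y y′ d → d :* (c :* y :+ y′) := c :* (d :* y) :+ d :* y′) refl
                    c (y nothing) (y′ nothing) (val a j)

  substitute-cong : ∀ {q n m} (val : Fin q → V (Fin m)) (l : Line q n) {y y′} → y ≗ y′ → ∀ x j →
    substitute val l y x j ≡ substitute val l y′ x j
  substitute-cong val l y≗y′ x j with lookup l x
  ... | nothing = y≗y′ (just j)
  ... | just a  = cong (val a j *_) (y≗y′ nothing)

  substitute-active : ∀ {q n m} (val : Fin q → V (Fin m)) (l : Line q n) y {x} j → lookup l x ≡ nothing →
    substitute val l y x j ≡ y (just j)
  substitute-active val l y j eq rewrite eq = refl

  substitute-point : ∀ {q n m} (val : Fin q → V (Fin m)) (l : Line q n) {y} a → val a ≗ y → ∀ x j →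
    val (lookup (l [ a ]) x) j ≡ substitute val l (point y) x j
  substitute-point val l a eq x j rewrite lookup-map x (Maybe.fromMaybe a) l with lookup l x
  ... | nothing = eq j
  ... | just b  = sym (*-identityʳ _)

  module FromCube (K n m : ℕ) where

    -- A letter is an m-tuple of subsets of `Fin K`: subset j lists the vertices whose bit is 1 in
    -- direction j.
    q : ℕ
    q = (2 ^ K) ^ m

    decode : Fin q → Fin m → Fin K → Fin 2
    decode a j = finToFun (finToFun a j)

    encode : (Fin m → Fin K → Fin 2) → Fin q
    encode s = funToFin (funToFin ∘ s)

    decode∘encode : ∀ s j i → decode (encode s) j i ≡ s j i
    decode∘encode s j i = trans (cong (λ z → finToFun z i) (finToFun-funToFin (funToFin ∘ s) j))
                                (finToFun-funToFin (s j) i)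

    -- The first K coordinates only tell the vertices apart; they make the K vertices attached to a
    -- word linearly independent.
    vertex : Word q n → Fin K → Fin K ⊎ (Fin n × Fin m) → Fin 2
    vertex w i (inj₁ i′) with i ≟ i′
    ... | yes _ = suc zero
    ... | no _  = zero
    vertex w i (inj₂ (x , j)) = decode (lookup w x) j i

    vertexSpan : Word q n → Fin K ⊸ Maybe (Fin K ⊎ (Fin n × Fin m))
    vertexSpan w = record
      { to        = to′
      ; to-cong   = λ { eq nothing → sum-cong-≗ eq
                      ; eq (just (inj₁ i)) → eq i
                      ; eq (just (inj₂ (x , j))) → sum-cong-≗ λ i → cong (bit (decode (lookup w x) j i) *_) (eq i) }
      ; linear    = λ { c y y′ nothing → sum-linear c y y′
                      ; c y y′ (just (inj₁ i)) → refl
                      ; c y y′ (just (inj₂ (x , j))) → trans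
                          (sum-cong-≗ λ i → solve 4 (λ c y y′ d → d :* (c :* y :+ y′) := c :* (d :* y) :+ d :* y′) refl
                            c (y i) (y′ i) (bit (decode (lookup w x) j i)))
                          (sum-linear c (λ i → bit (decode (lookup w x) j i) * y i) (λ i → bit (decode (lookup w x) j i) * y′ i)) }
      ; injective = λ y y≡0 i → y≡0 (just (inj₁ i))
      }
      where
      to′ : V (Fin K) → V (Maybe (Fin K ⊎ (Fin n × Fin m)))
      to′ y nothing                = sum y
      to′ y (just (inj₁ i))        = y i
      to′ y (just (inj₂ (x , j)))  = subset-sum y (decode (lookup w x) j)

    vertexSpan-e : ∀ w i → to (vertexSpan w) (e i) ≗ point (bit ∘ vertex w i)
    vertexSpan-e w i nothing = sum-e≡1 i
    vertexSpan-e w i (just (inj₁ i′)) with i ≟ i′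
    ... | yes _ = refl
    ... | no _  = refl
    vertexSpan-e w i (just (inj₂ (x , j))) = trans
      (sum-cong-≗ λ i′ → *-comm (bit (decode (lookup w x) j i′)) (e i i′))
      (sum-e (λ i′ → bit (decode (lookup w x) j i′)) i)

    module _ (l : Line q n) (act : Active l) (x : V (Fin K)) (x≢0 : ∃[ i ] x i ≢ 0#) where

      val : Fin q → V (Fin m)
      val a j = subset-sum x (decode a j)

      affine : Maybe (Fin m) ⊸ Maybe (Fin K ⊎ (Fin n × Fin m))
      affine = record
        { to        = to′
        ; to-cong   = λ { eq nothing → cong (sum x *_) (eq nothing)
                        ; eq (just (inj₁ i)) → cong (x i *_) (eq nothing)
                        ; eq (just (inj₂ (r , j))) → substitute-cong val l eq r j }
        ; linear    = λ { c y y′ nothing → homogeneous (sum x) c y y′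
                        ; c y y′ (just (inj₁ i)) → homogeneous (x i) c y y′
                        ; c y y′ (just (inj₂ (r , j))) → substitute-linear val l c y y′ r j }
        -- The sum of `x` may vanish, so the coordinate `nothing` need not detect the base point;
        -- the private coordinate of a vertex with nonzero coefficient does.
        ; injective = λ { y y≡0 nothing → *-≢0 (proj₂ x≢0) (y≡0 (just (inj₁ (proj₁ x≢0))))
                        ; y y≡0 (just j) → trans (sym (substitute-active val l y j (proj₂ act)))
                                                 (y≡0 (just (inj₂ (proj₁ act , j)))) }
        }
        where
        to′ : V (Maybe (Fin m)) → V (Maybe (Fin K ⊎ (Fin n × Fin m)))
        to′ y nothing               = sum x * y nothing
        to′ y (just (inj₁ i))       = x i * y nothing
        to′ y (just (inj₂ (r , j))) = substitute val l y r j
        homogeneous : ∀ d c (y y′ : V (Maybe (Fin m))) →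
          d * (c * y nothing + y′ nothing) ≡ c * (d * y nothing) + d * y′ nothing
        homogeneous d c y y′ = solve 4 (λ c y y′ d → d :* (c :* y :+ y′) := c :* (d :* y) :+ d :* y′) refl
          c (y nothing) (y′ nothing) d

      vertexSpan-line : ∀ {y} a → val a ≗ y → to (vertexSpan (l [ a ])) x ≗ to affine (point y)
      vertexSpan-line a eq nothing                = sym (*-identityʳ _)
      vertexSpan-line a eq (just (inj₁ i))        = sym (*-identityʳ _)
      vertexSpan-line a eq (just (inj₂ (r , j)))  = substitute-point val l a eq r j

  -- Each word yields K vertices of a coloured cube. Along a line of words with equal patterns, one
  -- combination `x` of them keeps its colour, while at the wildcards its coordinates are subset
  -- sums of `x`, hence arbitrary.
  coloured-affine : ∀ k m → ∃[ N ] ∀ (C : Colouring (Fin N)) → BasisColoured C →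
    MonoSubspace (suc k) C ⊎ Σ (Maybe (Fin m) ⊸ Fin N) λ ψ → AffineColoured (pull C ψ)
  coloured-affine k m with coloured-support k p
  ... | K , support with hales-jewett ((2 ^ K) ^ m) (3 ^ (p ^ K))
  ...   | n , hj with coloured-cube k (K ℕ.+ n ℕ.* m)
  ...     | N , cube = N , λ C basis →
              [ inj₁ , (λ (ψ , col) → Sum.map (mono-pull {k = suc k} C ψ) (λ (ψ′ , col′) → ψ ⊚ ψ′ , col′) (find (pull C ψ) col)) ]′
                (cube C basis)
    where
    Coord : Set
    Coord = Fin K ⊎ (Fin n × Fin m)
    toCoord : Fin (K ℕ.+ n ℕ.* m) → Coord
    toCoord = Sum.map₂ (remQuot m) ∘ splitAt K
    fromCoord : Coord → Fin (K ℕ.+ n ℕ.* m)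
    fromCoord = join K (n ℕ.* m) ∘ Sum.map₂ (λ (x , j) → combine x j)
    toCoord∘fromCoord : ∀ i → toCoord (fromCoord i) ≡ i
    toCoord∘fromCoord (inj₁ i)       = cong (Sum.map₂ (remQuot m)) (splitAt-join K (n ℕ.* m) (inj₁ i))
    toCoord∘fromCoord (inj₂ (x , j)) = trans (cong (Sum.map₂ (remQuot m)) (splitAt-join K (n ℕ.* m) (inj₂ (combine x j))))
                                     (cong inj₂ (remQuot-combine x j))
    relabel : Maybe Coord ⊸ Maybe (Fin (K ℕ.+ n ℕ.* m))
    relabel = reindex (Maybe.map toCoord) (Maybe.map fromCoord) λ { nothing → refl ; (just i) → cong just (toCoord∘fromCoord i) }
    find : ∀ (C : Colouring (Maybe (Fin (K ℕ.+ n ℕ.* m)))) → CubeColoured C →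
      MonoSubspace (suc k) C ⊎ Σ (Maybe (Fin m) ⊸ Maybe (Fin (K ℕ.+ n ℕ.* m))) λ ψ → AffineColoured (pull C ψ)
    find C (ρ , ρ≢0 , cubeρ) with hj (λ w → colourCode (pull (pull C relabel) (FromCube.vertexSpan K n m w)))
    ... | l , act , same = Sum.map (mono-pull {k = suc k} C (relabel ⊚ vertexSpan w₀)) conclude
          (support (pull D (vertexSpan w₀)) λ i → ρ≢0 ∘ trans (sym (on-vertex i)))
      where
      D : Colouring (Maybe Coord)
      D = pull C relabel
      open FromCube K n m
      w₀ : Word q n
      w₀ = l [ encode (λ _ _ → zero) ]
      on-vertex : ∀ i → χ D (to (vertexSpan w₀) (e i)) ≡ ρ
      on-vertex i = begin
        χ D (to (vertexSpan w₀) (e i))             ≡⟨ χ-cong D (vertexSpan-e w₀ i) ⟩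
        χ D (point (bit ∘ vertex w₀ i))            ≡⟨ χ-cong C (λ { nothing → refl ; (just _) → refl }) ⟩
        χ C (point (bit ∘ vertex w₀ i ∘ toCoord))  ≡⟨ cubeρ _ ⟩
        ρ                                          ∎
        where open ≡-Reasoning
      conclude : ∃[ x ] Support≥ (suc p) x × χ D (to (vertexSpan w₀) x) ≢ zero →
        Σ (Maybe (Fin m) ⊸ Maybe (Fin (K ℕ.+ n ℕ.* m))) λ ψ → AffineColoured (pull C ψ)
      -- The affine space takes the colour of the combination `x`, which may differ from the colour
      -- ρ of the cube.
      conclude (x , supp , c) = relabel ⊚ affine l act x x≢0 , χ D (to (vertexSpan w₀) x) , c , λ y →
        let s  = λ j → proj₁ (cover (y j))
            eq = λ j → trans (sum-cong-≗ λ i → cong (λ b → bit b * x i) (decode∘encode s j i)) (proj₂ (cover (y j)))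
        in trans (sym (χ-cong D (vertexSpan-line l act x x≢0 (encode s) eq)))
                 (colourCode-injective (pull D (vertexSpan (l [ encode s ]))) (pull D (vertexSpan w₀)) (same _ _) x)
        where
        cover = subset-sums-cover x supp (ℕ.n≤1+n p)
        x≢0 : ∃[ i ] x i ≢ 0#
        x≢0 = proj₁ supp zero , proj₂ (proj₂ supp) zero

  -- Homogeneous subspaces

  identity : ∀ {I} → I ⊸ I
  identity = reindex id id λ _ → refl

  atInfinity : ∀ {m} → Fin m ⊸ Maybe (Fin m)
  atInfinity = record
    { to        = λ y → maybe y 0#
    ; to-cong   = λ { eq nothing → refl ; eq (just i) → eq i }
    ; linear    = λ { c y y′ nothing → sym (trans (+-identityʳ _) (zeroʳ c)) ; c y y′ (just i) → refl }
    ; injective = λ y y≡0 i → y≡0 (just i)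
    }

  module FromWords (n m : ℕ) where

    -- Letters encode all vectors of length m, so a monochromatic line of words is a monochromatic
    -- affine space of dimension m. The leading 1 keeps it off the origin.
    wordPoint : Word (p ^ m) n → V (Fin (suc (n ℕ.* m)))
    wordPoint w zero    = 1#
    wordPoint w (suc r) = let x , j = remQuot {n} m r in finToFun (lookup w x) j

    module _ (l : Line (p ^ m) n) (act : Active l) where

      affineOfLine : Maybe (Fin m) ⊸ Fin (suc (n ℕ.* m))
      affineOfLine = record
        { to        = to′
        ; to-cong   = λ { eq zero → eq nothing
                        ; eq (suc r) → let x , j = remQuot {n} m r in substitute-cong finToFun l eq x j }
        ; linear    = λ { c y y′ zero → refl
                        ; c y y′ (suc r) → let x , j = remQuot {n} m r in substitute-linear finToFun l c y y′ x j }
        ; injective = λ { y y≡0 nothing → y≡0 zero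
                        ; y y≡0 (just j) → trans (sym (substitute-active finToFun l y j (proj₂ act)))
                            (trans (cong (λ (x , j) → substitute finToFun l y x j) (sym (remQuot-combine (proj₁ act) j)))
                                   (y≡0 (suc (combine (proj₁ act) j)))) }
        }
        where
        to′ : V (Maybe (Fin m)) → V (Fin (suc (n ℕ.* m)))
        to′ y zero    = y nothing
        to′ y (suc r) = let x , j = remQuot {n} m r in substitute finToFun l y x j

      affineOfLine-point : ∀ y → wordPoint (l [ funToFin y ]) ≗ to affineOfLine (point y)
      affineOfLine-point y zero    = refl
      affineOfLine-point y (suc r) = let x , j = remQuot {n} m r in
        substitute-point finToFun l (funToFin y) (decode-encode y) x j

  Nonzero : ∀ {n} → V (Fin n) → Set
  Nonzero y = ∃[ i ] y i ≢ 0#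

  -- κ i is the colour of every vector whose first nonzero coordinate is i.
  leading-colours : ∀ K → ∃[ m ] ∀ (C : Colouring (Fin m)) → Σ (Fin K ⊸ Fin m) λ φ →
    Σ (Fin K → Fin 3) λ κ → ∀ y → Nonzero y → ∃[ i ] y i ≢ 0# × χ C (to φ y) ≡ κ i
  leading-colours zero    = 0 , λ C → identity , (λ ()) , λ { y (() , _) }
  leading-colours (suc K) with leading-colours K
  ... | m , IH with hales-jewett (p ^ m) 3
  ...   | n , hj = suc (n ℕ.* m) , find
    where
    open FromWords n m
    find : ∀ (C : Colouring (Fin (suc (n ℕ.* m)))) → Σ (Fin (suc K) ⊸ Fin (suc (n ℕ.* m))) λ φ →
      Σ (Fin (suc K) → Fin 3) λ κ → ∀ y → Nonzero y → ∃[ i ] y i ≢ 0# × χ C (to φ y) ≡ κ i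
    find C with hj (χ C ∘ wordPoint)
    -- Recursion on the directions of the affine space just found.
    ... | l , act , same with IH (pull C (affineOfLine l act ⊚ atInfinity))
    ...   | φ , κ , lead = ψ ⊚ φ⁺ , κ⁺ , lead⁺
      where
      ψ = affineOfLine l act
      φ⁺ : Fin (suc K) ⊸ Maybe (Fin m)
      φ⁺ = record
        { to        = λ y → maybe (to φ (y ∘ suc)) (y zero)
        ; to-cong   = λ { eq nothing → eq zero ; eq (just j) → to-cong φ (eq ∘ suc) j }
        ; linear    = λ { c y y′ nothing → refl ; c y y′ (just j) → linear φ c (y ∘ suc) (y′ ∘ suc) j }
        ; injective = λ { y y≡0 zero → y≡0 nothing ; y y≡0 (suc i) → injective φ (y ∘ suc) (y≡0 ∘ just) i }
        }
      κ₀ : Fin 3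
      κ₀ = χ C (to ψ (point λ _ → 0#))
      κ⁺ : Fin (suc K) → Fin 3
      κ⁺ zero    = κ₀
      κ⁺ (suc i) = κ i
      constant : ∀ y → χ C (to ψ (point y)) ≡ κ₀
      constant y = begin
        χ C (to ψ (point y))                       ≡⟨ χ-cong C (affineOfLine-point l act y) ⟨
        χ C (wordPoint (l [ funToFin y ]))         ≡⟨ same _ _ ⟩
        χ C (wordPoint (l [ funToFin zeroes ]))    ≡⟨ χ-cong C (affineOfLine-point l act zeroes) ⟩
        κ₀                                         ∎
        where
        open ≡-Reasoning
        zeroes : V (Fin m)
        zeroes _ = 0#
      lead⁺ : ∀ y → Nonzero y → ∃[ i ] y i ≢ 0# × χ C (to (ψ ⊚ φ⁺) y) ≡ κ⁺ i
      lead⁺ y (i , yi≢0) with y zero ≟ 0#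
      -- A nonzero first coordinate can be scaled to 1, which lands in the monochromatic affine
      -- space; otherwise the vector is a direction and the recursion applies.
      ... | no y₀≢0 = zero , y₀≢0 , normalise
        where
        normalise : χ C (to (ψ ⊚ φ⁺) y) ≡ κ₀
        normalise with inverse (y zero) y₀≢0
        ... | z , zy₀≡1 = begin
          χ C (to (ψ ⊚ φ⁺) y)                     ≡⟨ χ-scale (pull C (ψ ⊚ φ⁺)) (inverse-≢0 zy₀≡1) y ⟨
          χ C (to (ψ ⊚ φ⁺) (λ i → z * y i))       ≡⟨ χ-cong (pull C ψ) (λ { nothing → zy₀≡1 ; (just _) → refl }) ⟩
          χ C (to ψ (point (to φ (λ i → z * y (suc i))))) ≡⟨ constant _ ⟩
          κ₀                                      ∎
          where
          open ≡-Reasoning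
      ... | yes y₀≡0 = let i , yi , eq = lead (y ∘ suc) (tail-nonzero i yi≢0) in
          suc i , yi , trans (χ-cong (pull C ψ) (λ { nothing → y₀≡0 ; (just _) → refl })) eq
        where
        tail-nonzero : ∀ i → y i ≢ 0# → Nonzero (y ∘ suc)
        tail-nonzero zero    y₀≢0 = contradiction y₀≡0 y₀≢0
        tail-nonzero (suc i) yi≢0 = i , yi≢0

  -- Restrict to k + 1 coordinates on which κ agrees. The coordinate that determines the colour of a
  -- vector is nonzero there, so it is one of those kept.
  homogeneous-subspace : ∀ k → ∃[ m ] ∀ (C : Colouring (Fin m)) →
    Σ (Fin (suc k) ⊸ Fin m) λ φ → ∃[ κ ] ∀ y → Nonzero y → χ C (to φ y) ≡ κ
  homogeneous-subspace k with pigeonhole-many (suc k) 3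
  ... | K , select with leading-colours K
  ...   | m , H = m , find
    where
    find : ∀ (C : Colouring (Fin m)) → Σ (Fin (suc k) ⊸ Fin m) λ φ → ∃[ κ ] ∀ y → Nonzero y → χ C (to φ y) ≡ κ
    find C with H C
    ... | φ , κ , lead with select κ
    ...   | g , g-inj , same = φ ⊚ extend g g-inj , κ (g zero) , colour
      where
      colour : ∀ y → Nonzero y → χ C (to φ (to (extend g g-inj) y)) ≡ κ (g zero)
      colour y (i , yi≢0) with lead (to (extend g g-inj) y) (g i , yi≢0 ∘ trans (sym (extendTo-image g g-inj y i)))
      ... | r , xr≢0 , eq with any? (λ i → g i ≟ r)
      ...   | yes (i′ , refl) = trans eq (same i′ zero)
      ...   | no off = contradiction (extendTo-off g g-inj y r λ i eq → off (i , eq)) xr≢0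

  affine⇒mono : ∀ k → ∃[ m ] ∀ (C : Colouring (Maybe (Fin m))) → AffineColoured C → MonoSubspace (suc k) C
  affine⇒mono k with homogeneous-subspace k
  ... | m , H = m , win
    where
    win : ∀ (C : Colouring (Maybe (Fin m))) → AffineColoured C → MonoSubspace (suc k) C
    win C (ρ , ρ≢0 , affρ) with H (pull C atInfinity)
    ... | φ , κ , constant with κ ≟ zero
    ...   | no κ≢0 = atInfinity ⊚ φ , κ , κ≢0 , (λ i → constant (e i) (i , 1≢0 ∘ trans (sym (e-diag i)))) , on-span
      where
      on-span : ∀ x → χ C (to (atInfinity ⊚ φ) x) ≡ zero ⊎ χ C (to (atInfinity ⊚ φ) x) ≡ κ
      on-span x with any? (λ i → nonzero? (x i))
      ... | yes nz = inj₂ (constant x nz)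
      ... | no  z  = inj₁ (trans (χ-cong (pull C (atInfinity ⊚ φ)) λ i → decidable-stable (x i ≟ 0#) λ xi → z (i , xi))
                                 (χ-zero (pull C (atInfinity ⊚ φ))))
    ...   | yes κ≡0 = affine , ρ , ρ≢0 , on-basis , on-span
      where
      affine : Fin (suc k) ⊸ Maybe (Fin m)
      affine = record
        -- With the coordinate sum as homogenising coordinate, unit vectors land in the coloured
        -- affine space, sum zero means a direction of value 0, and any other sum scales to 1.
        { to        = λ z → maybe (to φ z) (sum z)
        ; to-cong   = λ { eq nothing → sum-cong-≗ eq ; eq (just j) → to-cong φ eq j }
        ; linear    = λ { c y y′ nothing → sum-linear c y y′ ; c y y′ (just j) → linear φ c y y′ j }
        ; injective = λ y y≡0 → injective φ y (y≡0 ∘ just)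
        }
      on-basis : ∀ i → χ C (to affine (e i)) ≡ ρ
      on-basis i = trans (χ-cong C λ { nothing → sum-e≡1 i
                                     ; (just _) → refl }) (affρ (to φ (e i)))
      on-span : ∀ x → χ C (to affine x) ≡ zero ⊎ χ C (to affine x) ≡ ρ
      on-span x with sum x ≟ 0# | any? (λ i → nonzero? (x i))
      ... | yes s≡0 | yes nz = inj₁ (trans (χ-cong C λ { nothing → s≡0 ; (just _) → refl }) (trans (constant x nz) κ≡0))
      ... | yes s≡0 | no z   = inj₁ (trans (χ-cong (pull C affine) λ i → decidable-stable (x i ≟ 0#) λ xi → z (i , xi))
                                           (χ-zero (pull C affine)))
      ... | no s≢0  | _      = inj₂ normalise
        where
        normalise : χ C (to affine x) ≡ ρ
        normalise with inverse (sum x) s≢0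
        ... | z , zs≡1 = begin
          χ C (to affine x)                      ≡⟨ χ-scale (pull C affine) (inverse-≢0 zs≡1) x ⟨
          χ C (to affine (λ i → z * x i))
            ≡⟨ χ-cong C (λ { nothing → trans (sym (*-distribˡ-sum z x)) zs≡1 ; (just _) → refl }) ⟩
          χ C (point (to φ (λ i → z * x i)))     ≡⟨ affρ _ ⟩
          ρ                                      ∎
          where
          open ≡-Reasoning

  mono-subspace : ∀ k → ∃[ N ] ∀ (C : Colouring (Fin N)) → BasisColoured C → MonoSubspace (suc k) C
  mono-subspace k = combine-affine (affine⇒mono k)
    where
    via : ∀ {m N} → (∀ (C : Colouring (Maybe (Fin m))) → AffineColoured C → MonoSubspace (suc k) C) →
      (∀ (C : Colouring (Fin N)) → BasisColoured C →
        MonoSubspace (suc k) C ⊎ Σ (Maybe (Fin m) ⊸ Fin N) λ ψ → AffineColoured (pull C ψ)) →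
      ∀ (C : Colouring (Fin N)) → BasisColoured C → MonoSubspace (suc k) C
    via win H C basis with H C basis
    ... | inj₁ w         = w
    ... | inj₂ (ψ , col) = mono-pull {k = suc k} C ψ (win (pull C ψ) col)
    combine-affine : (∃[ m ] ∀ (C : Colouring (Maybe (Fin m))) → AffineColoured C → MonoSubspace (suc k) C) →
      ∃[ N ] ∀ (C : Colouring (Fin N)) → BasisColoured C → MonoSubspace (suc k) C
    combine-affine (m , win) = proj₁ (coloured-affine k m) , via win (proj₂ (coloured-affine k m))

-- The field GF(p)

rawRing : ∀ {p} → PrimeField p → RawRing 0ℓ 0ℓ
rawRing {p} 𝔽 = record
  { Carrier = Fin p ; _≈_ = _≡_ ; _+_ = _+_ ; _*_ = _*_ ; -_ = -_ ; 0# = 0# ; 1# = 1# }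
  where open PrimeField 𝔽

module GaloisField {p : ℕ} (pr : Prime p) where
  open RawRing (GF pr) using (_+_; _*_; -_; 0#; 1#)

  instance
    p≢0 : NonZero p
    p≢0 = prime⇒nonZero pr

  ι : ℕ → Fin p
  ι n = n mod p

  toℕ-ι : ∀ n → toℕ (ι n) ≡ n % p
  toℕ-ι n = toℕ-fromℕ< _

  ι-cong : ∀ {m n} → m % p ≡ n % p → ι m ≡ ι n
  ι-cong {m} {n} eq = toℕ-injective (trans (toℕ-ι m) (trans eq (sym (toℕ-ι n))))

  ι-toℕ : ∀ x → ι (toℕ x) ≡ x
  ι-toℕ x = toℕ-injective (trans (toℕ-ι (toℕ x)) (m<n⇒m%n≡m (toℕ<n x)))

  ι-+ : ∀ m n → ι m + ι n ≡ ι (m ℕ.+ n)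
  ι-+ m n = ι-cong (trans (cong₂ (λ a b → (a ℕ.+ b) % p) (toℕ-ι m) (toℕ-ι n)) (sym (%-distribˡ-+ m n p)))

  ι-* : ∀ m n → ι m * ι n ≡ ι (m ℕ.* n)
  ι-* m n = ι-cong (trans (cong₂ (λ a b → (a ℕ.* b) % p) (toℕ-ι m) (toℕ-ι n)) (sym (%-distribˡ-* m n p)))

  -- Every residue is the class of a natural number, so the ring laws reduce to those of ℕ through
  -- `ι-+` and `ι-*`.
  ι-elim : (P : Fin p → Set) → (∀ n → P (ι n)) → ∀ x → P x
  ι-elim P Pι x = subst P (ι-toℕ x) (Pι (toℕ x))

  ι-elim₂ : (P : Fin p → Fin p → Set) → (∀ m n → P (ι m) (ι n)) → ∀ x y → P x y
  ι-elim₂ P Pι x y = subst₂ P (ι-toℕ x) (ι-toℕ y) (Pι (toℕ x) (toℕ y))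

  ι-elim₃ : (P : Fin p → Fin p → Fin p → Set) → (∀ l m n → P (ι l) (ι m) (ι n)) → ∀ x y z → P x y z
  ι-elim₃ P Pι x = ι-elim (λ x → ∀ y z → P x y z) (λ l → ι-elim₂ (P (ι l)) (Pι l)) x

  +-assoc : ∀ x y z → (x + y) + z ≡ x + (y + z)
  +-assoc = ι-elim₃ _ λ l m n → begin
    ι l + ι m + ι n         ≡⟨ cong (_+ ι n) (ι-+ l m) ⟩
    ι (l ℕ.+ m) + ι n       ≡⟨ ι-+ (l ℕ.+ m) n ⟩
    ι (l ℕ.+ m ℕ.+ n)       ≡⟨ cong ι (ℕ.+-assoc l m n) ⟩
    ι (l ℕ.+ (m ℕ.+ n))     ≡⟨ ι-+ l (m ℕ.+ n) ⟨
    ι l + ι (m ℕ.+ n)       ≡⟨ cong (ι l +_) (ι-+ m n) ⟨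
    ι l + (ι m + ι n)       ∎
    where open ≡-Reasoning

  *-assoc : ∀ x y z → (x * y) * z ≡ x * (y * z)
  *-assoc = ι-elim₃ _ λ l m n → begin
    ι l * ι m * ι n         ≡⟨ cong (_* ι n) (ι-* l m) ⟩
    ι (l ℕ.* m) * ι n       ≡⟨ ι-* (l ℕ.* m) n ⟩
    ι (l ℕ.* m ℕ.* n)       ≡⟨ cong ι (ℕ.*-assoc l m n) ⟩
    ι (l ℕ.* (m ℕ.* n))     ≡⟨ ι-* l (m ℕ.* n) ⟨
    ι l * ι (m ℕ.* n)       ≡⟨ cong (ι l *_) (ι-* m n) ⟨
    ι l * (ι m * ι n)       ∎
    where open ≡-Reasoning

  distribˡ : ∀ x y z → x * (y + z) ≡ x * y + x * z
  distribˡ = ι-elim₃ _ λ l m n → begin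
    ι l * (ι m + ι n)               ≡⟨ cong (ι l *_) (ι-+ m n) ⟩
    ι l * ι (m ℕ.+ n)               ≡⟨ ι-* l (m ℕ.+ n) ⟩
    ι (l ℕ.* (m ℕ.+ n))             ≡⟨ cong ι (ℕ.*-distribˡ-+ l m n) ⟩
    ι (l ℕ.* m ℕ.+ l ℕ.* n)         ≡⟨ ι-+ (l ℕ.* m) (l ℕ.* n) ⟨
    ι (l ℕ.* m) + ι (l ℕ.* n)       ≡⟨ cong₂ _+_ (ι-* l m) (ι-* l n) ⟨
    ι l * ι m + ι l * ι n           ∎
    where open ≡-Reasoning

  +-comm : ∀ x y → x + y ≡ y + x
  +-comm x y = cong ι (ℕ.+-comm (toℕ x) (toℕ y))

  *-comm : ∀ x y → x * y ≡ y * x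
  *-comm x y = cong ι (ℕ.*-comm (toℕ x) (toℕ y))

  +-identityˡ : ∀ x → 0# + x ≡ x
  +-identityˡ = ι-elim _ (ι-+ 0)

  *-identityˡ : ∀ x → 1# * x ≡ x
  *-identityˡ = ι-elim _ λ n → trans (ι-* 1 n) (cong ι (ℕ.*-identityˡ n))

  -‿inverseʳ : ∀ x → x + - x ≡ 0#
  -‿inverseʳ x = begin
    x + - x                          ≡⟨ cong (_+ - x) (ι-toℕ x) ⟨
    ι (toℕ x) + ι (p ℕ.∸ toℕ x)      ≡⟨ ι-+ (toℕ x) (p ℕ.∸ toℕ x) ⟩
    ι (toℕ x ℕ.+ (p ℕ.∸ toℕ x))      ≡⟨ cong ι (ℕ.m+[n∸m]≡n (ℕ.<⇒≤ (toℕ<n x))) ⟩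
    ι p                              ≡⟨ ι-cong (trans (n%n≡0 p) (sym (m*n%n≡0 0 p))) ⟩
    0#                               ∎
    where open ≡-Reasoning

  isCommutativeRing : IsCommutativeRing _≡_ _+_ _*_ -_ 0# 1#
  isCommutativeRing = record
    { isRing = record
      { +-isAbelianGroup = record
        { isGroup = record
          { isMonoid = record
            { isSemigroup = record
              { isMagma = record { isEquivalence = isEquivalence ; ∙-cong = cong₂ _+_ }
              ; assoc = +-assoc }
            ; identity = +-identityˡ , λ x → trans (+-comm x 0#) (+-identityˡ x) }
          ; inverse = (λ x → trans (+-comm (- x) x) (-‿inverseʳ x)) , -‿inverseʳ
          ; ⁻¹-cong = cong -_ }
        ; comm = +-comm }
      ; *-cong = cong₂ _*_
      ; *-assoc = *-assoc
      ; *-identity = *-identityˡ , λ x → trans (*-comm x 1#) (*-identityˡ x)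
      ; distrib = distribˡ , λ x y z → trans (*-comm (y + z) x)
                               (trans (distribˡ x y z) (cong₂ _+_ (*-comm x y) (*-comm x z))) }
    ; *-comm = *-comm }

  commutativeRing : CommutativeRing 0ℓ 0ℓ
  commutativeRing = record { isCommutativeRing = isCommutativeRing }

  open CommutativeRing commutativeRing using (ring; +-identityʳ)
  open RingProperties ring using (-‿distribˡ-*)

  toℕ-1≢0 : toℕ 1# ≢ 0
  toℕ-1≢0 eq = ℕ.1+n≢0 (trans (sym (m<n⇒m%n≡m (ℕ.nonTrivial⇒n>1 p {{prime⇒nonTrivial pr}}))) (trans (sym (toℕ-ι 1)) eq))

  1≢0 : 1# ≢ 0#
  1≢0 eq = toℕ-1≢0 (trans (cong toℕ eq) (trans (toℕ-ι 0) (m*n%n≡0 0 p)))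

  multiple-of-p : ∀ k → ι (k ℕ.* p) ≡ 0#
  multiple-of-p k = ι-cong (trans (m*n%n≡0 k p) (sym (m*n%n≡0 0 p)))

  inverse : ∀ x → x ≢ 0# → ∃[ y ] y * x ≡ 1#
  inverse x x≢0 with coprime-Bézout (prime⇒coprime pr {{ℕ.≢-nonZero toℕx≢0}} (toℕ<n x))
    where
    toℕx≢0 : toℕ x ≢ 0
    toℕx≢0 eq = x≢0 (trans (sym (ι-toℕ x)) (cong ι eq))
  ... | Bézout.-+ a b eq = ι b , (begin
    ι b * x                ≡⟨ cong (ι b *_) (ι-toℕ x) ⟨
    ι b * ι (toℕ x)        ≡⟨ ι-* b (toℕ x) ⟩
    ι (b ℕ.* toℕ x)        ≡⟨ cong ι eq ⟨
    ι (1 ℕ.+ a ℕ.* p)      ≡⟨ ι-cong ([m+kn]%n≡m%n 1 a p) ⟩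
    1#                     ∎)
    where open ≡-Reasoning
  -- Here the Bézout identity reads 1 + b x = a p, so the inverse is minus the class of b.
  ... | Bézout.+- a b eq = - ι b , (begin
    - ι b * x                        ≡⟨ -‿distribˡ-* (ι b) x ⟨
    - (ι b * x)                      ≡⟨ +-identityˡ _ ⟨
    0# + - (ι b * x)                 ≡⟨ cong (_+ - (ι b * x)) zero-sum ⟨
    1# + ι b * x + - (ι b * x)       ≡⟨ +-assoc 1# _ _ ⟩
    1# + (ι b * x + - (ι b * x))     ≡⟨ cong (1# +_) (-‿inverseʳ (ι b * x)) ⟩
    1# + 0#                          ≡⟨ +-identityʳ 1# ⟩
    1#                               ∎)
    where
    open ≡-Reasoning
    zero-sum : 1# + ι b * x ≡ 0#
    zero-sum = begin
      1# + ι b * x                 ≡⟨ cong (λ z → 1# + ι b * z) (ι-toℕ x) ⟨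
      1# + ι b * ι (toℕ x)         ≡⟨ cong (1# +_) (ι-* b (toℕ x)) ⟩
      1# + ι (b ℕ.* toℕ x)         ≡⟨ ι-+ 1 _ ⟩
      ι (1 ℕ.+ b ℕ.* toℕ x)        ≡⟨ cong ι eq ⟩
      ι (a ℕ.* p)                  ≡⟨ multiple-of-p a ⟩
      0#                           ∎

  1-generated : ∀ (P : Fin p → Set) → P 0# → (∀ {x} → P x → P (x + 1#)) → ∀ x → P x
  1-generated P P0 P+1 = ι-elim P all
    where
    all : ∀ n → P (ι n)
    all zero    = P0
    all (suc n) = subst P (trans (ι-+ n 1) (cong ι (ℕ.+-comm n 1))) (P+1 (all n))

  primeField : PrimeField p
  primeField = record
    { isCommutativeRing = isCommutativeRing
    ; 1≢0 = 1≢0 ; inverse = inverse ; 1-generated = 1-generated }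

-- Flats of represented matroids

elements : ∀ {n} (X : Subset n) → Fin ∣ X ∣ → Fin n
elements (inside  ∷ X) zero    = zero
elements (inside  ∷ X) (suc i) = suc (elements X i)
elements (outside ∷ X) i       = suc (elements X i)

elements-injective : ∀ {n} (X : Subset n) → Injective _≡_ _≡_ (elements X)
elements-injective (inside  ∷ X) {zero}  {zero}  eq = refl
elements-injective (inside  ∷ X) {suc i} {suc j} eq = cong suc (elements-injective X (suc-injective eq))
elements-injective (outside ∷ X)                 eq = elements-injective X (suc-injective eq)

elements-∈ : ∀ {n} (X : Subset n) i → elements X i ∈ X
elements-∈ (inside  ∷ X) zero    = here
elements-∈ (inside  ∷ X) (suc i) = there (elements-∈ X i)
elements-∈ (outside ∷ X) i       = there (elements-∈ X i)

∣p∪⁅x⁆∣≡1+∣p∣ : ∀ {n} (X : Subset n) {e} → e ∉ X → ∣ X ∪ ⁅ e ⁆ ∣ ≡ suc ∣ X ∣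
∣p∪⁅x⁆∣≡1+∣p∣ (inside  ∷ X) {zero}  e∉X = contradiction here e∉X
∣p∪⁅x⁆∣≡1+∣p∣ (outside ∷ X) {zero}  e∉X = cong (suc ∘ ∣_∣) (∪-identityʳ X)
∣p∪⁅x⁆∣≡1+∣p∣ (inside  ∷ X) {suc e} e∉X = cong suc (∣p∪⁅x⁆∣≡1+∣p∣ X (e∉X ∘ there))
∣p∪⁅x⁆∣≡1+∣p∣ (outside ∷ X) {suc e} e∉X = ∣p∪⁅x⁆∣≡1+∣p∣ X (e∉X ∘ there)

-- The recursion adds the first value on the right, so that the image of `cons e` below is
-- definitionally `image g ∪ ⁅ e ⁆`, the form in which exchange delivers it.
image : ∀ {k n} → (Fin k → Fin n) → Subset n
image {zero}  g = ⊥
image {suc k} g = image (g ∘ suc) ∪ ⁅ g zero ⁆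

∈-image⁺ : ∀ {k n} (g : Fin k → Fin n) i → g i ∈ image g
∈-image⁺ g zero    = x∈p∪q⁺ (inj₂ (x∈⁅x⁆ (g zero)))
∈-image⁺ g (suc i) = x∈p∪q⁺ (inj₁ (∈-image⁺ (g ∘ suc) i))

∈-image⁻ : ∀ {k n} (g : Fin k → Fin n) {e} → e ∈ image g → ∃[ i ] g i ≡ e
∈-image⁻ {zero}  g e∈ = contradiction e∈ ∉⊥
∈-image⁻ {suc k} g e∈ with x∈p∪q⁻ (image (g ∘ suc)) ⁅ g zero ⁆ e∈
... | inj₁ e∈′ = let i , eq = ∈-image⁻ (g ∘ suc) e∈′ in suc i , eq
... | inj₂ e∈′ = zero , sym (x∈⁅y⁆⇒x≡y (g zero) e∈′)

∣image∣ : ∀ {k n} (g : Fin k → Fin n) → Injective _≡_ _≡_ g → ∣ image g ∣ ≡ k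
∣image∣ {zero}  {n} g g-inj = ∣⊥∣≡0 n
∣image∣ {suc k} g g-inj = trans
  (∣p∪⁅x⁆∣≡1+∣p∣ (image (g ∘ suc)) λ g₀∈ → case g-inj (proj₂ (∈-image⁻ (g ∘ suc) g₀∈)) of λ ())
  (cong suc (∣image∣ (g ∘ suc) (suc-injective ∘ g-inj)))

module _ {n : ℕ} {P : Fin n → Set} (P? : ∀ e → Dec (P e)) where

  comprehension : Subset n
  comprehension = tabulate (does ∘ P?)

  ∈-comprehension⁺ : ∀ {e} → P e → e ∈ comprehension
  ∈-comprehension⁺ {e} Pe = lookup⇒[]= e _ (trans (lookup∘tabulate (does ∘ P?) e) (dec-true (P? e) Pe))

  ∈-comprehension⁻ : ∀ {e} → e ∈ comprehension → P e
  ∈-comprehension⁻ {e} e∈ with P? e | trans (sym (lookup∘tabulate (does ∘ P?) e)) ([]=⇒lookup e∈)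
  ... | yes Pe | _ = Pe
  ... | no _   | ()

∈-subsets : ∀ {n} (X : Subset n) → X ∈ˡ subsets n
∈-subsets []            = here refl
∈-subsets (inside  ∷ X) = ∈-++⁺ˡ (∈-map⁺ (inside ∷_) (∈-subsets X))
∈-subsets (outside ∷ X) = ∈-++⁺ʳ _ (∈-map⁺ (outside ∷_) (∈-subsets X))

-- Rank, and the points of a simple matroid

module _ {n : ℕ} (M : Matroid n) where
  open Matroid M

  rank-upper : ∀ {I X} → Indep I → I ⊆ X → ∣ I ∣ ≤ rank M X
  rank-upper {I} {X} indep I⊆X = All.lookup (xs≤max 0 _)
    (∈-map⁺ ∣_∣ (∈-filter⁺ (λ J → Indep? J ×-dec (J ⊆? X)) (∈-subsets I) (indep , I⊆X)))

  rank-attained : ∀ X → ∃[ I ] Indep I × I ⊆ X × ∣ I ∣ ≡ rank M X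
  rank-attained X with argmax-sel id 0 (List.map ∣_∣ (List.filter (λ J → Indep? J ×-dec (J ⊆? X)) (subsets n)))
  ... | inj₁ eq = ⊥ , empty , ⊥⊆ , trans (∣⊥∣≡0 n) (sym eq)
  ... | inj₂ r∈ with ∈-map⁻ ∣_∣ r∈
  ...   | I , I∈ , eq with ∈-filter⁻ (λ J → Indep? J ×-dec (J ⊆? X)) {xs = subsets n} I∈
  ...     | _ , indep , I⊆X = I , indep , I⊆X , sym eq

  module SimpleMatroid (simple : Simple M) where

    indep-single : ∀ e → Indep ⁅ e ⁆
    indep-single e = decidable-stable (Indep? ⁅ e ⁆) (proj₁ simple e)

    indep-pair : ∀ {e f} → e ≢ f → Indep (⁅ e ⁆ ∪ ⁅ f ⁆)
    indep-pair {e} {f} e≢f = decidable-stable (Indep? _) λ dep →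
      proj₂ simple e f (e≢f , proj₁ simple e , proj₁ simple f , dep)

    ∣pair∣ : ∀ {e f : Fin n} → e ≢ f → ∣ ⁅ e ⁆ ∪ ⁅ f ⁆ ∣ ≡ 2
    ∣pair∣ {e} {f} e≢f = trans (∣p∪⁅x⁆∣≡1+∣p∣ ⁅ e ⁆ λ f∈ → e≢f (sym (x∈⁅y⁆⇒x≡y e f∈))) (cong suc (∣⁅x⁆∣≡1 e))

    rank≢1 : ∀ {X e f} → e ≢ f → e ∈ X → f ∈ X → rank M X ≢ 1
    rank≢1 {X} {e} {f} e≢f e∈X f∈X r≡1 = ℕ.1+n≰n (subst₂ _≤_ (∣pair∣ e≢f) r≡1 (rank-upper (indep-pair e≢f) pair⊆X))
      where
      pair⊆X : ⁅ e ⁆ ∪ ⁅ f ⁆ ⊆ X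
      pair⊆X x∈ with x∈p∪q⁻ ⁅ e ⁆ ⁅ f ⁆ x∈
      ... | inj₁ x∈e rewrite x∈⁅y⁆⇒x≡y e x∈e = e∈X
      ... | inj₂ x∈f rewrite x∈⁅y⁆⇒x≡y f x∈f = f∈X

    rank-single : ∀ e → rank M ⁅ e ⁆ ≡ 1
    rank-single e with rank-attained ⁅ e ⁆
    ... | I , indep , I⊆e , eq = ℕ.≤-antisym
      (subst₂ _≤_ eq (∣⁅x⁆∣≡1 e) (p⊆q⇒∣p∣≤∣q∣ I⊆e))
      (subst (_≤ rank M ⁅ e ⁆) (∣⁅x⁆∣≡1 e) (rank-upper (indep-single e) ⊆-refl))

    single-flat : ∀ e → IsRankFlat M 1 ⁅ e ⁆
    single-flat e = closed , rank-single e
      where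
      closed : IsFlat M ⁅ e ⁆
      closed f eq = decidable-stable (f ∈? ⁅ e ⁆) λ f∉ →
        rank≢1 {e = e} {f} (λ { refl → f∉ (x∈⁅x⁆ e) })
          (x∈p∪q⁺ (inj₁ (x∈⁅x⁆ e))) (x∈p∪q⁺ (inj₂ (x∈⁅x⁆ f))) (trans eq (rank-single e))

    rank-1⇒single : ∀ X → rank M X ≡ 1 → ∃[ e ] X ≡ ⁅ e ⁆
    rank-1⇒single X r≡1 with rank-attained X
    ... | I , indep , I⊆X , eq = e , ⊆-antisym X⊆e e⊆X
      where
      i : Fin ∣ I ∣
      i = subst Fin (sym (trans eq r≡1)) zero
      e = elements I i
      e∈X : e ∈ X
      e∈X = I⊆X (elements-∈ I i)
      X⊆e : X ⊆ ⁅ e ⁆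
      X⊆e {f} f∈X with e ≟ f
      ... | yes refl = x∈⁅x⁆ e
      ... | no e≢f   = contradiction r≡1 (rank≢1 e≢f e∈X f∈X)
      e⊆X : ⁅ e ⁆ ⊆ X
      e⊆X f∈e rewrite x∈⁅y⁆⇒x≡y e f∈e = e∈X

    element : Fin n → Point M
    element e = ⁅ e ⁆ , irr (single-flat e)

    point-element : (P : Point M) → ∃[ e ] value P ≡ ⁅ e ⁆
    -- The flatness proof is irrelevant; the element is recovered from it because being a singleton
    -- is decidable.
    point-element (X , irr flat) = recompute (any? λ e → ≡-dec Bool._≟_ X ⁅ e ⁆) (rank-1⇒single X (proj₂ flat))

    -- Points with the same underlying set are definitionally equal, by irrelevance of the proof
    -- component.
    colour-of-point : ∀ {A : Set} (c : Point M → A) (P : Point M) {e} → value P ≡ ⁅ e ⁆ → c P ≡ c (element e)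
    colour-of-point c (X , irr _) refl = refl

-- Spans of columns as flats

module Represented {p : ℕ} (𝔽 : PrimeField p) {n : ℕ} (M : Matroid n) {m : ℕ}
  (A : Fin m → Fin n → Fin p)
  (rep : ∀ X → Matroid.Indep M X ⇔ ColumnsIndependent (rawRing 𝔽) A X) where
  open Matroid M
  open Linear 𝔽

  combine-columns : ∀ {k} → (Fin k → Fin n) → V (Fin k) → V (Fin m)
  combine-columns g x i = sum (λ j → x j * A i (g j))

  indep⇒injective : ∀ {k I} (g : Fin k → Fin n) → Injective _≡_ _≡_ g → (∀ i → g i ∈ I) → Indep I →
    ∀ x → (∀ i → combine-columns g x i ≡ 0#) → ∀ j → x j ≡ 0#
  indep⇒injective g g-inj g∈I indep x x≡0 = injective (extend g g-inj) x
    (Equivalence.to (rep _) indep (to (extend g g-inj) x)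
      (λ e e∉I → extendTo-off g g-inj x e λ { j refl → e∉I (g∈I j) })
      (λ i → trans (extend-sum g g-inj x (A i)) (x≡0 i)))

  injective⇒indep : ∀ {k} (g : Fin k → Fin n) → Injective _≡_ _≡_ g →
    (∀ x → (∀ i → combine-columns g x i ≡ 0#) → ∀ j → x j ≡ 0#) → Indep (image g)
  injective⇒indep g g-inj inj = Equivalence.from (rep _) independent
    where
    independent : ColumnsIndependent (rawRing 𝔽) A (image g)
    independent c off c≡0 = vanishes
      where
      restricted : to (extend g g-inj) (c ∘ g) ≗ c
      restricted e with any? (λ j → g j ≟ e)
      ... | yes (j , refl) = extendTo-image g g-inj (c ∘ g) j
      ... | no e∉g = trans (extendTo-off g g-inj (c ∘ g) e λ j eq → e∉g (j , eq))
                           (sym (off e λ e∈ → e∉g (∈-image⁻ g e∈)))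
      on-image : ∀ j → c (g j) ≡ 0#
      on-image = inj (c ∘ g) λ i → trans (sym (extend-sum g g-inj (c ∘ g) (A i)))
        (trans (sum-cong-≗ λ e → cong (_* A i e) (restricted e)) (c≡0 i))
      vanishes : ∀ e → c e ≡ 0#
      vanishes e with e ∈? image g
      ... | yes e∈ with j , refl ← ∈-image⁻ g e∈ = on-image j
      ... | no e∉  = off e e∉

  span : ∀ {k} (g : Fin k → Fin n) → Injective _≡_ _≡_ g → Indep (image g) → Fin k ⊸ Fin m
  span g g-inj indep = record
    { to        = combine-columns g
    ; to-cong   = λ x≗y i → sum-cong-≗ λ j → cong (_* A i (g j)) (x≗y j)
    ; linear    = λ c x y i → trans
        (sum-cong-≗ λ j → solve 4 (λ c x y d → (c :* x :+ y) :* d := c :* (x :* d) :+ y :* d) refl c (x j) (y j) (A i (g j)))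
        (sum-linear c (λ j → x j * A i (g j)) (λ j → y j * A i (g j)))
    ; injective = indep⇒injective g g-inj (∈-image⁺ g) indep
    }

  InSpan : ∀ {k} → (Fin k → Fin n) → Fin n → Set
  InSpan g e = ∃[ x ] ∀ i → combine-columns g x i ≡ A i e

  inSpan? : ∀ {k} (g : Fin k → Fin n) e → Dec (InSpan g e)
  inSpan? g e = anyVector?
    (λ x≗y eq i → trans (sum-cong-≗ λ j → cong (_* A i (g j)) (sym (x≗y j))) (eq i))
    (λ x → all? λ i → combine-columns g x i ≟ A i e)

  module SpanFlat {k : ℕ} (g : Fin k → Fin n) (g-inj : Injective _≡_ _≡_ g) (indep : Indep (image g)) where

    flat : Subset n
    flat = comprehension (inSpan? g)

    image⊆flat : image g ⊆ flat
    image⊆flat e∈ with j , refl ← ∈-image⁻ g e∈ = ∈-comprehension⁺ (inSpan? g) (e j , λ i → sum-e (λ j′ → A i (g j′)) j)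

    cons : Fin n → Fin (suc k) → Fin n
    cons e zero    = e
    cons e (suc j) = g j

    cons-injective : ∀ {e} → e ∉ image g → Injective _≡_ _≡_ (cons e)
    cons-injective e∉ {zero}  {zero}  _    = refl
    cons-injective e∉ {zero}  {suc j} refl = contradiction (∈-image⁺ g j) e∉
    cons-injective e∉ {suc i} {zero}  refl = contradiction (∈-image⁺ g i) e∉
    cons-injective e∉ {suc i} {suc j} eq   = cong suc (g-inj eq)

    inSpan⇒dep : ∀ {e} → e ∉ image g → InSpan g e → ¬ Indep (image g ∪ ⁅ e ⁆)
    inSpan⇒dep {e} e∉ (x , eq) indep⁺ = 1≢0 (trans (sym (-‿involutive 1#)) (trans (cong -_ minus-one) -0#≈0#))
      where
      x⁺ : V (Fin (suc k))
      x⁺ zero    = - 1#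
      x⁺ (suc j) = x j
      minus-one : - 1# ≡ 0#
      minus-one = indep⇒injective (cons e) (cons-injective e∉) (∈-image⁺ (cons e)) indep⁺ x⁺ (λ i → begin
        - 1# * A i e + combine-columns g x i  ≡⟨ cong (- 1# * A i e +_) (eq i) ⟩
        - 1# * A i e + A i e                  ≡⟨ cong (- 1# * A i e +_) (*-identityˡ _) ⟨
        - 1# * A i e + 1# * A i e             ≡⟨ distribʳ (A i e) (- 1#) 1# ⟨
        (- 1# + 1#) * A i e                   ≡⟨ cong (_* A i e) (-‿inverseˡ 1#) ⟩
        0# * A i e                            ≡⟨ zeroˡ _ ⟩
        0#                                    ∎) zero
        where open ≡-Reasoning

    notInSpan⇒indep : ∀ {e} → ¬ InSpan g e → Indep (image g ∪ ⁅ e ⁆)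
    notInSpan⇒indep {e} e∉span = injective⇒indep (cons e) (cons-injective e∉) inj
      where
      e∉ : e ∉ image g
      e∉ e∈ = e∉span (∈-comprehension⁻ (inSpan? g) (image⊆flat e∈))
      inj : ∀ x → (∀ i → combine-columns (cons e) x i ≡ 0#) → ∀ j → x j ≡ 0#
      inj x x≡0 = λ { zero → x₀≡0 ; (suc j) → tail≡0 j }
        where
        open ≡-Reasoning
        x₀≡0 : x zero ≡ 0#
        x₀≡0 = decidable-stable (x zero ≟ 0#) λ x₀≢0 → e∉span (solution x₀≢0)
          where
          solution : x zero ≢ 0# → InSpan g e
          solution x₀≢0 with inverse (x zero) x₀≢0
          ... | z , zx₀≡1 = (λ j → - z * x (suc j)) , λ i → begin
            combine-columns g (λ j → - z * x (suc j)) i            ≡⟨ to-scale (span g g-inj indep) (- z) (x ∘ suc) i ⟩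
            - z * combine-columns g (x ∘ suc) i                    ≡⟨ +-identityʳ _ ⟨
            - z * combine-columns g (x ∘ suc) i + 0#
              ≡⟨ cong (- z * combine-columns g (x ∘ suc) i +_) (trans (cong (_* A i e) (-‿inverseʳ (z * x zero))) (zeroˡ _)) ⟨
            - z * combine-columns g (x ∘ suc) i
              + (z * x zero + - (z * x zero)) * A i e
                ≡⟨ cong (λ w → - z * combine-columns g (x ∘ suc) i + (z * x zero + w) * A i e) (-‿distribˡ-* z (x zero)) ⟩
            - z * combine-columns g (x ∘ suc) i
              + (z * x zero + - z * x zero) * A i e
                ≡⟨ solve 5 (λ z m x a s → m :* s :+ (z :* x :+ m :* x) :* a := z :* x :* a :+ m :* (x :* a :+ s)) refl
                                                                        z (- z) (x zero) (A i e) (combine-columns g (x ∘ suc) i) ⟩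
            z * x zero * A i e
              + - z * (x zero * A i e + combine-columns g (x ∘ suc) i) ≡⟨ cong₂ (λ a b → a * A i e + - z * b) zx₀≡1 (x≡0 i) ⟩
            1# * A i e + - z * 0#                                  ≡⟨ cong₂ _+_ (*-identityˡ _) (zeroʳ _) ⟩
            A i e + 0#                                             ≡⟨ +-identityʳ _ ⟩
            A i e                                                  ∎
        tail≡0 : ∀ j → x (suc j) ≡ 0#
        tail≡0 = indep⇒injective g g-inj (∈-image⁺ g) indep (x ∘ suc) λ i → begin
          combine-columns g (x ∘ suc) i                    ≡⟨ +-identityˡ _ ⟨
          0# + combine-columns g (x ∘ suc) i
            ≡⟨ cong (_+ combine-columns g (x ∘ suc) i) (trans (cong (_* A i e) x₀≡0) (zeroˡ _)) ⟨
          x zero * A i e + combine-columns g (x ∘ suc) i   ≡⟨ x≡0 i ⟩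
          0#                                               ∎

    rank-flat : rank M flat ≡ k
    rank-flat = ℕ.≤-antisym upper (subst (_≤ rank M flat) (∣image∣ g g-inj) (rank-upper M indep image⊆flat))
      where
      upper : rank M flat ≤ k
      upper with rank-attained M flat
      ... | J , indepJ , J⊆flat , eq = ℕ.≮⇒≥ λ k<r →
        -- A larger independent set in the flat would extend `image g` by a column that already lies
        -- in its span.
        let e , e∈J , e∉ , indep⁺ = exchange indep indepJ (subst₂ _<_ (sym (∣image∣ g g-inj)) (sym eq) k<r)
        in inSpan⇒dep e∉ (∈-comprehension⁻ (inSpan? g) (J⊆flat e∈J)) indep⁺

    isRankFlat : IsRankFlat M k flat
    isRankFlat = closed , rank-flat
      where
      closed : IsFlat M flat
      closed e eq = decidable-stable (e ∈? flat) λ e∉flat →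
        let e∉span  = e∉flat ∘ ∈-comprehension⁺ (inSpan? g)
            e∉image = e∉flat ∘ image⊆flat
        -- A column outside the span makes `image g ∪ ⁅ e ⁆` independent with k + 1 elements, too
        -- many for rank k.
        in ℕ.1+n≰n (subst₂ _≤_
             (trans (∣p∪⁅x⁆∣≡1+∣p∣ (image g) e∉image) (cong suc (∣image∣ g g-inj)))
             (trans eq rank-flat)
             (rank-upper M (notInSpan⇒indep e∉span) (∪-monoˡ e)))
        where
        ∪-monoˡ : ∀ e → image g ∪ ⁅ e ⁆ ⊆ flat ∪ ⁅ e ⁆
        ∪-monoˡ e x∈ = x∈p∪q⁺ (Sum.map₁ image⊆flat (x∈p∪q⁻ (image g) ⁅ e ⁆ x∈))

  -- The colouring of the ambient space by the points

  module ColouredPoints (simple : Simple M) (c : Point M → Fin 2)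
    {N : ℕ} (b : Fin N → Fin n) (b-inj : Injective _≡_ _≡_ b) (indep : Indep (image b)) where
    open SimpleMatroid M simple

    W : Fin N ⊸ Fin m
    W = span b b-inj indep

    On : V (Fin m) → Fin n → Set
    On v e = ∃[ a ] a ≢ 0# × (∀ i → v i ≡ a * A i e)

    on? : ∀ v e → Dec (On v e)
    on? v e = any? λ a → nonzero? a ×-dec all? λ i → v i ≟ a * A i e

    -- Simplicity enters here: distinct columns are independent, so no vector is a nonzero multiple
    -- of both.
    on-unique : ∀ {v e f} → On v e → On v f → e ≡ f
    on-unique {v} {e} {f} (a , a≢0 , va) (a′ , _ , va′) = decidable-stable (e ≟ f) λ e≢f →
      a≢0 (indep⇒injective (pair e f) (pair-injective e≢f) pair∈ (indep-pair e≢f) x (λ i → begin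
        a * A i e + (- a′ * A i f + 0#)   ≡⟨ cong (a * A i e +_) (+-identityʳ _) ⟩
        a * A i e + - a′ * A i f          ≡⟨ cong₂ _+_ (va i) (-‿distribˡ-* a′ (A i f)) ⟨
        v i + - (a′ * A i f)              ≡⟨ cong (λ z → v i + - z) (va′ i) ⟨
        v i + - v i                       ≡⟨ -‿inverseʳ (v i) ⟩
        0#                                ∎) zero)
      where
      open ≡-Reasoning
      pair : Fin n → Fin n → Fin 2 → Fin n
      pair e f zero    = e
      pair e f (suc _) = f
      pair-injective : e ≢ f → Injective _≡_ _≡_ (pair e f)
      pair-injective e≢f {zero}     {zero}     _  = refl
      pair-injective e≢f {zero}     {suc zero} eq = contradiction eq e≢f
      pair-injective e≢f {suc zero} {zero}     eq = contradiction (sym eq) e≢f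
      pair-injective e≢f {suc zero} {suc zero} _  = refl
      pair∈ : ∀ j → pair e f j ∈ ⁅ e ⁆ ∪ ⁅ f ⁆
      pair∈ zero    = x∈p∪q⁺ (inj₁ (x∈⁅x⁆ e))
      pair∈ (suc _) = x∈p∪q⁺ (inj₂ (x∈⁅x⁆ f))
      x : V (Fin 2)
      x zero    = a
      x (suc _) = - a′

    on-nonzero : ∀ {v e} → On v e → ¬ (∀ i → v i ≡ 0#)
    on-nonzero {v} {e} (a , a≢0 , va) v≡0 = a≢0
      (indep⇒injective {1} (λ _ → e) (λ { {zero} {zero} _ → refl }) (λ _ → x∈⁅x⁆ e) (indep-single e) (λ _ → a)
        (λ i → trans (+-identityʳ _) (trans (sym (va i)) (v≡0 i))) zero)

    on-cong : ∀ {v w e} → v ≗ w → On v e → On w e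
    on-cong v≗w (a , a≢0 , va) = a , a≢0 , λ i → trans (sym (v≗w i)) (va i)

    on-scale : ∀ {s v e} → s ≢ 0# → On v e → On (λ i → s * v i) e
    on-scale {s} s≢0 (a , a≢0 , va) = s * a , a≢0 ∘ *-≢0 s≢0 , λ i → trans (cong (s *_) (va i)) (sym (*-assoc s a _))

    on-unscale : ∀ {s v e} → s ≢ 0# → On (λ i → s * v i) e → On v e
    on-unscale {s} {v} s≢0 on with z , zs≡1 ← inverse s s≢0 = on-cong
      (λ i → trans (sym (*-assoc z s (v i))) (trans (cong (_* v i) zs≡1) (*-identityˡ _)))
      (on-scale (inverse-≢0 zs≡1) on)

    colour : V (Fin m) → Fin 3
    colour v with any? (on? v)
    ... | yes (e , _) = suc (c (element e))
    ... | no _        = zero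

    colour-on : ∀ {v e} → On v e → colour v ≡ suc (c (element e))
    colour-on {v} {e} on with any? (on? v)
    ... | yes (f , on′) = cong (suc ∘ c ∘ element) (on-unique on′ on)
    ... | no none       = contradiction (e , on) none

    colour-off : ∀ {v} → (∀ e → ¬ On v e) → colour v ≡ zero
    colour-off {v} off with any? (on? v)
    ... | yes (e , on) = contradiction on (off e)
    ... | no _         = refl

    colour-coloured : ∀ {v} → colour v ≢ zero → ∃[ e ] On v e
    colour-coloured {v} c≢0 = decidable-stable (any? (on? v)) λ none → c≢0 (colour-off λ e on → none (e , on))

    colour-resp : ∀ {v w} → (∀ {e} → On v e → On w e) → (∀ {e} → On w e → On v e) → colour v ≡ colour w
    colour-resp {v} v⇒w w⇒v with any? (on? v)
    ... | yes (e , on) = sym (colour-on (v⇒w on))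
    ... | no none      = sym (colour-off λ e on → none (e , w⇒v on))

    ambient : Colouring (Fin m)
    ambient = record
      { χ       = colour
      ; χ-cong  = λ v≗w → colour-resp (on-cong v≗w) (on-cong (sym ∘ v≗w))
      ; χ-zero  = colour-off λ e on → on-nonzero on λ _ → refl
      ; χ-scale = λ s≢0 v → colour-resp (on-unscale s≢0) (on-scale s≢0)
      }

    coloured-basis : ∀ j → colour (to W (e j)) ≢ zero
    coloured-basis j eq = case trans (sym eq) (colour-on {e = b j} (1# , 1≢0 ,
      λ i → trans (sum-e (λ j′ → A i (b j′)) j) (sym (*-identityˡ _)))) of λ ()

    -- The coloured basis vectors are multiples of columns, whose span is the whole space. A column
    -- in that span is a coloured vector, so its value can only be ρ.
    monochromatic-flat : ∀ {k} → MonoSubspace k ambient → ∃[ F ] IsRankFlat M k F × Monochromatic M c F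
    monochromatic-flat {k} (φ , ρ , ρ≢0 , on-basis , on-span) = flat , isRankFlat , mono
      where
      chosen : ∀ s → ∃[ f ] On (to φ (e s)) f
      chosen s = colour-coloured (ρ≢0 ∘ trans (sym (on-basis s)))
      f : Fin k → Fin n
      f s = proj₁ (chosen s)
      a : V (Fin k)
      a s = proj₁ (proj₂ (chosen s))
      a≢0 : ∀ s → a s ≢ 0#
      a≢0 s = proj₁ (proj₂ (proj₂ (chosen s)))
      column : ∀ s i → to φ (e s) i ≡ a s * A i (f s)
      column s = proj₂ (proj₂ (proj₂ (chosen s)))
      a⁻¹ : V (Fin k)
      a⁻¹ s = proj₁ (inverse (a s) (a≢0 s))
      a⁻¹a≡1 : ∀ s → a⁻¹ s * a s ≡ 1#
      a⁻¹a≡1 s = proj₂ (inverse (a s) (a≢0 s))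
      from-columns : ∀ x i → combine-columns f x i ≡ to φ (λ s → a⁻¹ s * x s) i
      from-columns x i = sym (begin
        to φ (λ s → a⁻¹ s * x s) i                       ≡⟨ expand φ (λ s → a⁻¹ s * x s) i ⟩
        sum (λ s → a⁻¹ s * x s * to φ (e s) i)           ≡⟨ sum-cong-≗ (λ s → cong (a⁻¹ s * x s *_) (column s i)) ⟩
        sum (λ s → a⁻¹ s * x s * (a s * A i (f s)))
          ≡⟨ sum-cong-≗ (λ s → solve 4 (λ z x a d → z :* x :* (a :* d) := z :* a :* (x :* d)) refl
                                                             (a⁻¹ s) (x s) (a s) (A i (f s))) ⟩
        sum (λ s → a⁻¹ s * a s * (x s * A i (f s)))
          ≡⟨ sum-cong-≗ (λ s → trans (cong (_* (x s * A i (f s))) (a⁻¹a≡1 s)) (*-identityˡ _)) ⟩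
        combine-columns f x i                            ∎)
        where open ≡-Reasoning
      f-inj : Injective _≡_ _≡_ f
      -- If both basis vectors were multiples of one column, `a t * e s - a s * e t` would lie in
      -- the kernel of φ.
      f-inj {s} {t} fs≡ft = decidable-stable (s ≟ t) λ s≢t → a≢0 t (begin
        a t                                  ≡⟨ trans (cong₂ (λ u v → a t * u + - a s * v) (e-diag s) (e-off (s≢t ∘ sym)))
                                                  (trans (cong₂ _+_ (*-identityʳ _) (zeroʳ _)) (+-identityʳ _)) ⟨
        a t * e s s + - a s * e t s          ≡⟨ injective φ (λ j → a t * e s j + - a s * e t j) relation s ⟩
        0#                                   ∎)
        where
        open ≡-Reasoning
        relation : ∀ i → to φ (λ j → a t * e s j + - a s * e t j) i ≡ 0#
        relation i = begin
          to φ (λ j → a t * e s j + - a s * e t j) i               ≡⟨ linear φ (a t) (e s) _ i ⟩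
          a t * to φ (e s) i + to φ (λ j → - a s * e t j) i        ≡⟨ cong₂ (λ u v → a t * u + v) (column s i)
                                                                        (trans (to-scale φ (- a s) (e t) i) (cong (- a s *_) (column t i))) ⟩
          a t * (a s * A i (f s)) + - a s * (a t * A i (f t))
            ≡⟨ cong (λ u → a t * (a s * A i (f s)) + - a s * (a t * A i u)) fs≡ft ⟨
          a t * (a s * A i (f s)) + - a s * (a t * A i (f s))
            ≡⟨ solve 4 (λ x y m d → x :* (y :* d) :+ m :* (x :* d) := (y :+ m) :* (x :* d)) refl
                                                                        (a t) (a s) (- a s) (A i (f s)) ⟩
          (a s + - a s) * (a t * A i (f s))                        ≡⟨ cong (_* (a t * A i (f s))) (-‿inverseʳ (a s)) ⟩
          0# * (a t * A i (f s))                                   ≡⟨ zeroˡ _ ⟩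
          0#                                                       ∎
      indep-f : Indep (image f)
      indep-f = injective⇒indep f f-inj λ x x≡0 s →
        *-≢0 (inverse-≢0 (a⁻¹a≡1 s)) (injective φ (λ s → a⁻¹ s * x s) (λ i → trans (sym (from-columns x i)) (x≡0 i)) s)
      open SpanFlat f f-inj indep-f
      colour-in-flat : ∀ {e} → e ∈ flat → suc (c (element e)) ≡ ρ
      colour-in-flat {e} e∈ with ∈-comprehension⁻ (inSpan? f) e∈
      ... | x , eq = [ (λ z → case trans (sym on-e) z of λ ()) , trans (sym on-e) ]′ (on-span y)
        where
        y : V (Fin k)
        y s = a⁻¹ s * x s
        on-e : colour (to φ y) ≡ suc (c (element e))
        on-e = colour-on (1# , 1≢0 , λ i → trans (sym (from-columns x i)) (trans (eq i) (sym (*-identityˡ _))))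
      mono : Monochromatic M c flat
      mono P Q P⊆F Q⊆F with point-element P | point-element Q
      ... | e , P≡e | f , Q≡f = begin
        c P             ≡⟨ colour-of-point c P P≡e ⟩
        c (element e)   ≡⟨ suc-injective (trans (colour-in-flat (P⊆F (subst (e ∈_) (sym P≡e) (x∈⁅x⁆ e))))
                                                (sym (colour-in-flat (Q⊆F (subst (f ∈_) (sym Q≡f) (x∈⁅x⁆ f)))))) ⟩
        c (element f)   ≡⟨ colour-of-point c Q Q≡f ⟨
        c Q             ∎
        where open ≡-Reasoning

ramsey-for-field : ∀ {p} (𝔽 : PrimeField p) k →
  ∃[ N ] (∀ {n} (M : Matroid n) → Simple M → Representable (rawRing 𝔽) M → matroidRank M ≥ N →
    (c : Point M → Fin 2) → ∃[ F ] (IsRankFlat M (suc k) F × Monochromatic M c F))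
ramsey-for-field 𝔽 k = via (Ramsey.mono-subspace 𝔽 k)
  where
  open Linear 𝔽
  via : (∃[ N ] ∀ (C : Colouring (Fin N)) → BasisColoured C → MonoSubspace (suc k) C) →
    ∃[ N ] (∀ {n} (M : Matroid n) → Simple M → Representable (rawRing 𝔽) M → matroidRank M ≥ N →
      (c : Point M → Fin 2) → ∃[ F ] (IsRankFlat M (suc k) F × Monochromatic M c F))
  via (N , win) = N , find
    where
    find : ∀ {n} (M : Matroid n) → Simple M → Representable (rawRing 𝔽) M → matroidRank M ≥ N →
      (c : Point M → Fin 2) → ∃[ F ] (IsRankFlat M (suc k) F × Monochromatic M c F)
    find {n} M simple (m , A , rep) N≤r c with rank-attained M ⊤
    -- N columns of a maximum independent set form the coloured basis on which the search starts.
    ... | I , indep , _ , eq = monochromatic-flat (mono-pull {k = suc k} ambient W (win (pull ambient W) coloured-basis))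
      where
      N≤∣I∣ : N ≤ ∣ I ∣
      N≤∣I∣ = subst (N ≤_) (sym eq) N≤r
      b : Fin N → Fin n
      b j = elements I (inject≤ j N≤∣I∣)
      b-inj : Injective _≡_ _≡_ b
      b-inj eq = inject≤-injective N≤∣I∣ N≤∣I∣ _ _ (elements-injective I eq)
      image⊆I : image b ⊆ I
      image⊆I e∈ with j , refl ← ∈-image⁻ b e∈ = elements-∈ I (inject≤ j N≤∣I∣)
      open Represented 𝔽 M A rep
      open ColouredPoints simple c b b-inj (Matroid.hered M image⊆I indep)

corollary1p4 : ∀ (p : ℕ) (pr : Prime p) (k : ℕ) → k ≥ 1 →
    ∃[ N ] (∀ {n} (M : Matroid n) → Simple M → Representable (GF pr) M →
    matroidRank M ≥ N →
    (c : Point M → Fin 2) →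
    ∃[ F ] (IsRankFlat M k F × Monochromatic M c F))
-- The raw ring of `primeField pr` unfolds to `GF pr`, so both notions of representability agree
-- definitionally.
corollary1p4 p pr (suc k) _ = ramsey-for-field (GaloisField.primeField pr) k
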